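{- The path graph $P_{2m}$ (on $2m$ vertices, without loops), viewed as a target graph, is Hoffman-London for all $m\ge 1$ and strongly Hoffman-London for all $m\ge 2$.
   Context: For a target graph $H$ and a simple loopless graph $G$, an $H$-coloring of $G$ is a map $f:V(G)\to V(H)$ such that $f(u)\sim_H f(v)$ whenever $u\sim_G v$; $\hom(G,H)$ denotes the number of $H$-colorings of $G$. $\mathcal{T}_n$ is the set of all trees on $n$ vertices (up to isomorphism) and $P_n\in\mathcal{T}_n$ is the path on $n$ vertices. $H$ is Hoffman-London if for all $n\ge 1$, $\hom(P_n,H)=\min_{T_n\in\mathcal{T}_n}\hom(T_n,H)$; $H$ is strongly Hoffman-London if $\hom(P_n,H)<\hom(T_n,H)$ for all $n\ge 1$ and all $T_n\in\mathcal{T}_n\setminus\{P_n\}$. -}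

module Defs where

open import Data.Fin.Base using (Fin; zero; suc; toℕ; fromℕ; inject₁; finToFun)
open import Data.Fin.Properties using (all?)
open import Data.List.Base using (List; allFin; filter; length; map)
open import Data.Nat.Base using (ℕ; suc; _^_; _≤_; _<_; _≥_)
open import Data.Nat.Properties using (_≟_; 1+n≢n)
open import Data.Product.Base using (Σ-syntax; _×_)
open import Data.Sum.Base using (_⊎_; [_,_]; swap)
open import Function.Bundles using (_↔_; _⇔_; Inverse)
open import Function.Definitions using (Injective)
open import Level using (0ℓ)
open import Relation.Binary.Construct.Closure.ReflexiveTransitive using (Star)
open import Relation.Binary.Core using (Rel)
open import Relation.Binary.Definitions using (Decidable; Irreflexive; Symmetric)
open import Relation.Binary.PropositionalEquality using (_≡_; refl)
open import Relation.Nullary using (¬_; Dec)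
open import Relation.Nullary.Decidable using (_→-dec_; _⊎-dec_)

-- Finite undirected graphs on the vertex set Fin n. Loops are allowed: these
-- are the target graphs.
record Graph (n : ℕ) : Set₁ where
  field
    Adj     : Rel (Fin n) 0ℓ
    adj?    : Decidable Adj
    adj-sym : Symmetric Adj

record SimpleGraph (n : ℕ) : Set₁ where
  field
    graph    : Graph n
  open Graph graph public
  field
    loopless : Irreflexive _≡_ Adj

record _≅_ {n k : ℕ} (G : SimpleGraph n) (G′ : SimpleGraph k) : Set where
  private
    module G  = SimpleGraph G
    module G′ = SimpleGraph G′
  field
    bijection : Fin n ↔ Fin k
  open Inverse bijection public using (to)
  field
    adj-⇔     : ∀ u v → G.Adj u v ⇔ G′.Adj (to u) (to v)

-- A cycle with 3 + extra pairwise distinct vertices.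
record Cycle {n : ℕ} (G : SimpleGraph n) : Set where
  open SimpleGraph G using (Adj)
  field
    extra       : ℕ
  len : ℕ
  len = suc (suc (suc extra))
  field
    vertex      : Fin len → Fin n
    distinct    : Injective _≡_ _≡_ vertex
    consecutive : ∀ (i : Fin (suc (suc extra))) → Adj (vertex (inject₁ i)) (vertex (suc i))
    closing     : Adj (vertex (fromℕ (suc (suc extra)))) (vertex zero)

record IsTree {n : ℕ} (G : SimpleGraph n) : Set where
  open SimpleGraph G using (Adj)
  field
    nonEmpty  : n ≥ 1
    connected : ∀ u v → Star Adj u v
    acyclic   : ¬ Cycle G

PathAdj : (n : ℕ) → Rel (Fin n) 0ℓ
PathAdj n u v = suc (toℕ u) ≡ toℕ v ⊎ suc (toℕ v) ≡ toℕ u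

path : (n : ℕ) → SimpleGraph n
path n = record
  { graph = record
    { Adj     = PathAdj n
    ; adj?    = λ u v → (suc (toℕ u) ≟ toℕ v) ⊎-dec (suc (toℕ v) ≟ toℕ u)
    ; adj-sym = swap
    }
  ; loopless = λ { refl → [ 1+n≢n , 1+n≢n ] }
  }

IsColoring : ∀ {n k} → SimpleGraph n → Graph k → (Fin n → Fin k) → Set
IsColoring G H f = ∀ u v → SimpleGraph.Adj G u v → Graph.Adj H (f u) (f v)

isColoring? : ∀ {n k} (G : SimpleGraph n) (H : Graph k) (f : Fin n → Fin k) →
              Dec (IsColoring G H f)
isColoring? G H f =
  all? λ u → all? λ v → SimpleGraph.adj? G u v →-dec Graph.adj? H (f u) (f v)

-- finToFun is a bijection up to pointwise equality, so every map occurs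
-- exactly once in this list.
allMaps : (n k : ℕ) → List (Fin n → Fin k)
allMaps n k = map finToFun (allFin (k ^ n))

hom : ∀ {n k} → SimpleGraph n → Graph k → ℕ
hom {n} {k} G H = length (filter (isColoring? G H) (allMaps n k))

-- m is the minimum of hom(T, H) over the trees T on n vertices. Isomorphic
-- trees have equal hom(T, H), so labelled trees may stand in for isomorphism
-- classes.
IsMinHom : ∀ {k} → Graph k → (n : ℕ) → ℕ → Set₁
IsMinHom H n m =
  (Σ[ T ∈ SimpleGraph n ] IsTree T × hom T H ≡ m) ×
  (∀ (T : SimpleGraph n) → IsTree T → m ≤ hom T H)

HoffmanLondon : ∀ {k} → Graph k → Set₁
HoffmanLondon H = ∀ n → n ≥ 1 → IsMinHom H n (hom (path n) H)

StronglyHoffmanLondon : ∀ {k} → Graph k → Set₁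
StronglyHoffmanLondon H =
  ∀ n → n ≥ 1 → ∀ (T : SimpleGraph n) → IsTree T → ¬ (T ≅ path n) →
  hom (path n) H < hom T H

{-# OPTIONS --safe #-}
module Submission where

-- Let M be the adjacency operator of H = P₂ₘ, and call a function on V(H) monotone if it grows with
-- the distance to the nearer end of H.  Monotone functions are closed under products and under M,
-- so the number of colorings of a rooted tree is a monotone function of the color of the root.  Any
-- two monotone functions r, s are similarly ordered, and as Mᵃ is symmetric with nonnegative
-- entries, summing (r i − r j)(s i − s j) ≥ 0 against Mᵃ gives Chebyshev's inequality
-- ⟨ r , Mᵃ s ⟩ ≤ ⟨ r , Mᵃ1 · s ⟩.  It says that where two parts of a tree and a pendant path of length
-- a meet in a vertex, the number of colorings does not grow when the path is instead inserted
-- between the two parts; straightening all branches shows that paths are minimal.  For m ≥ 2 the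
-- step is strict as soon as r and s increase strictly from the ends of H, which happens at a vertex
-- of degree at least 3, and a tree without such a vertex is a path.

open import Defs
open import Data.Bool.Base using (if_then_else_)
open import Data.Empty using (⊥; ⊥-elim)
open import Data.Fin.Base using (Fin; zero; suc; toℕ; fromℕ; fromℕ<; inject₁; opposite; punchIn; punchOut;
  combine; finToFun; funToFin; _↑ˡ_; _↑ʳ_)
open import Data.Fin.Permutation using (Permutation; permutation; _⟨$⟩ˡ_; _⟨$⟩ʳ_; inverseˡ; inverseʳ; lift₀; reverse; ↔⇒≡)
open import Data.Fin.Properties using (_≟_; all?; any?; ¬∀⟶∃¬; toℕ<n; toℕ-fromℕ<; toℕ-injective; toℕ-inject₁;
  opposite-prop; opposite-involutive; injective⇒≤; punchIn-injective; punchInᵢ≢i; punchOut-injective;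
  punchIn-punchOut; finToFun-funToFin; funToFin-finToFin; remQuot-combine) renaming (suc-injective to sucᶠ-injective)
open import Data.Fin.Relation.Unary.Top using (view; ‵fromℕ; ‵inject₁)
open import Data.List.Base using (filter; length; map; tabulate)
open import Data.Nat.Base
open import Data.Nat.Properties hiding (_≟_)
open import Data.Nat.Properties using () renaming (_≟_ to _≟ℕ_)
open import Data.Nat.Tactic.RingSolver using (solve-∀)
open import Data.Product.Base using (∃; ∃₂; Σ-syntax; _×_; _,_; proj₁; proj₂)
open import Data.Sum.Base using (inj₁; inj₂; _⊎_)
open import Data.Vec.Functional using (updateAt; tail) renaming (_∷_ to _∷ᶠ_)
open import Data.Vec.Functional.Properties using (updateAt-updates)
open import Function.Base using (_∘_; const; id)
open import Function.Bundles using (_⇔_; mk⇔; Equivalence)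
open import Function.Construct.Composition using (_⇔-∘_; _↔-∘_)
open import Function.Construct.Identity using (↔-id)
open import Function.Construct.Symmetry using (↔-sym; ⇔-sym)
open import Function.Definitions using (Injective)
open import Level using (0ℓ)
open import Relation.Binary.Construct.Closure.ReflexiveTransitive using (Star; ε; _◅_; _◅◅_; gmap)
open import Relation.Binary.Core using (Rel)
open import Relation.Binary.Definitions using (Decidable; Irreflexive; Symmetric)
open import Relation.Binary.PropositionalEquality
open import Relation.Nullary using (¬_; Dec; yes; no; does; contradiction)
open import Relation.Nullary.Decidable using (_×-dec_; _⊎-dec_; dec-true)

open import Algebra.Properties.Semiring.Sum +-*-semiring
  using (sum; sum-syntax; sum-cong-≗; ∑-distrib-+; ∑-comm; sum-permute; sum-replicate-zero; *-distribˡ-sum; *-distribʳ-sum)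
open import Algebra.Properties.CommutativeMonoid.Sum *-1-commutativeMonoid
  using () renaming (sum to product; sum-cong-≗ to product-cong-≗)

private
  variable
    k l n : ℕ

-- Counting maps

𝟙 : ∀ {a} {A : Set a} → Dec A → ℕ
𝟙 a? = if does a? then 1 else 0

module _ {a b} {A : Set a} {B : Set b} where

  𝟙-cong : (a? : Dec A) (b? : Dec B) → A ⇔ B → 𝟙 a? ≡ 𝟙 b?
  𝟙-cong (yes _) (yes _) _   = refl
  𝟙-cong (yes a) (no ¬b) A⇔B = contradiction (Equivalence.to A⇔B a) ¬b
  𝟙-cong (no ¬a) (yes b) A⇔B = contradiction (Equivalence.from A⇔B b) ¬a
  𝟙-cong (no _)  (no _)  _   = refl

  𝟙-× : (a? : Dec A) (b? : Dec B) → 𝟙 (a? ×-dec b?) ≡ 𝟙 a? * 𝟙 b?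
  𝟙-× (yes _) (yes _) = refl
  𝟙-× (yes _) (no _)  = refl
  𝟙-× (no _)  _       = refl

𝟙-true : ∀ {a} {A : Set a} (a? : Dec A) → A → 𝟙 a? ≡ 1
𝟙-true a? a rewrite dec-true a? a = refl

length-filter-map-tabulate : ∀ {a b p} {A : Set a} {B : Set b} {P : B → Set p} (P? : ∀ b → Dec (P b))
  (f : A → B) (g : Fin n → A) → length (filter P? (map f (tabulate g))) ≡ ∑[ i < n ] 𝟙 (P? (f (g i)))
length-filter-map-tabulate {zero}  P? f g = refl
length-filter-map-tabulate {suc n} P? f g with P? (f (g zero))
... | yes _ = cong suc (length-filter-map-tabulate P? f (g ∘ suc))
... | no  _ = length-filter-map-tabulate P? f (g ∘ suc)

sum-+ : ∀ m (f : Fin (m + n) → ℕ) → sum f ≡ ∑[ i < m ] f (i ↑ˡ n) + ∑[ j < n ] f (m ↑ʳ j)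
sum-+ zero    f = refl
sum-+ (suc m) f = trans (cong (f zero +_) (sum-+ m (f ∘ suc))) (sym (+-assoc (f zero) _ _))

sum-combine : ∀ m (f : Fin (m * n) → ℕ) → sum f ≡ ∑[ i < m ] ∑[ j < n ] f (combine i j)
sum-combine zero    f = refl
sum-combine {n} (suc m) f =
  trans (sum-+ n f) (cong (∑[ j < n ] f (j ↑ˡ (m * n)) +_) (sum-combine m (f ∘ (n ↑ʳ_))))

∑maps : ((Fin n → Fin k) → ℕ) → ℕ
∑maps {n} {k} F = ∑[ i < k ^ n ] F (finToFun i)

-- Encoding a map and decoding it again returns it only up to pointwise equality, so reindexing
-- `∑maps` calls for a summand that respects `≗`.
Extensional : ((Fin n → Fin k) → ℕ) → Set
Extensional F = ∀ {f g} → f ≗ g → F f ≡ F g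

-- The code of a map on `suc n` points pairs its value at `zero` with the code of its tail.
∑maps-suc : (F : (Fin (suc n) → Fin k) → ℕ) → Extensional F →
            ∑maps F ≡ ∑[ a < k ] ∑maps (λ f → F (a ∷ᶠ f))
∑maps-suc {n} {k} F ext = trans (sum-combine k _) (sum-cong-≗ λ a → sum-cong-≗ λ b → ext (eq a b))
  where
  eq : ∀ a b → finToFun {k} {suc n} (combine a b) ≗ (a ∷ᶠ finToFun b)
  eq a b zero    = cong proj₁ (remQuot-combine a b)
  eq a b (suc j) = cong (λ ab → finToFun (proj₂ ab) j) (remQuot-combine {k} a b)

funToFin-cong : {f g : Fin n → Fin k} → f ≗ g → funToFin f ≡ funToFin g
funToFin-cong {zero}  eq = refl
funToFin-cong {suc n} eq = cong₂ combine (eq zero) (funToFin-cong (eq ∘ suc))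

precompose : ∀ k → Permutation n l → Permutation (k ^ l) (k ^ n)
precompose {n} {l} k π = permutation (λ i → funToFin (finToFun i ∘ (π ⟨$⟩ʳ_))) (λ i → funToFin (finToFun i ∘ (π ⟨$⟩ˡ_)))
  (λ i → trans (funToFin-cong λ j → trans (finToFun-funToFin _ (π ⟨$⟩ʳ j)) (cong (finToFun i) (inverseˡ π)))
               (funToFin-finToFin {n} {k} i))
  (λ i → trans (funToFin-cong λ j → trans (finToFun-funToFin _ (π ⟨$⟩ˡ j)) (cong (finToFun i) (inverseʳ π)))
               (funToFin-finToFin {l} {k} i))

∑maps-permute : (F : (Fin n → Fin k) → ℕ) → Extensional F → (π : Permutation n l) →
                ∑maps F ≡ ∑maps (λ f → F (f ∘ (π ⟨$⟩ʳ_)))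
∑maps-permute {n} {k} F ext π =
  trans (sum-permute (F ∘ finToFun {k} {n}) (precompose k π)) (sum-cong-≗ λ i → ext (finToFun-funToFin (finToFun {k} i ∘ (π ⟨$⟩ʳ_))))

module _ {G : SimpleGraph n} {H : Graph k} where

  IsColoring-cong : ∀ {f g : Fin n → Fin k} → f ≗ g → IsColoring G H f → IsColoring G H g
  IsColoring-cong eq col u v uv = subst₂ (Graph.Adj H) (eq u) (eq v) (col u v uv)

  𝟙-coloring-ext : Extensional (λ f → 𝟙 (isColoring? G H f))
  𝟙-coloring-ext eq = 𝟙-cong (isColoring? G H _) (isColoring? G H _)
    (mk⇔ (IsColoring-cong eq) (IsColoring-cong (sym ∘ eq)))

hom-∑maps : (G : SimpleGraph n) (H : Graph k) → hom G H ≡ ∑maps (λ f → 𝟙 (isColoring? G H f))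
hom-∑maps G H = length-filter-map-tabulate (isColoring? G H) finToFun id

hom-≅ : {G : SimpleGraph n} {G′ : SimpleGraph l} (H : Graph k) → G ≅ G′ → hom G H ≡ hom G′ H
hom-≅ {G = G} {G′} H iso = begin
  hom G H                                                        ≡⟨ hom-∑maps G H ⟩
  ∑maps (λ f → 𝟙 (isColoring? G H f))                            ≡⟨ ∑maps-permute _ (𝟙-coloring-ext {G = G} {H}) π ⟩
  ∑maps (λ f → 𝟙 (isColoring? G H (f ∘ (π ⟨$⟩ʳ_))))              ≡⟨ sum-cong-≗ (λ i → 𝟙-cong (isColoring? G H _) (isColoring? G′ H _) (pullback (finToFun i))) ⟩
  ∑maps (λ f → 𝟙 (isColoring? G′ H f))                           ≡⟨ hom-∑maps G′ H ⟨
  hom G′ H                                                       ∎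
  where
  open ≡-Reasoning
  open _≅_ iso using (bijection; adj-⇔)
  π = bijection
  pullback : ∀ f → IsColoring G H (f ∘ (π ⟨$⟩ʳ_)) ⇔ IsColoring G′ H f
  pullback f = mk⇔
    (λ col u v uv → subst₂ (Graph.Adj H) (cong f (inverseʳ π)) (cong f (inverseʳ π))
      (col _ _ (Equivalence.from (adj-⇔ _ _)
        (subst₂ (SimpleGraph.Adj G′) (sym (inverseʳ π)) (sym (inverseʳ π)) uv))))
    (λ col u v uv → col _ _ (Equivalence.to (adj-⇔ u v) uv))

-- Colorings of trees

-- A vertex is attached to an older one and becomes the new vertex zero.
data RecursiveTree : ℕ → Set where
  root   : RecursiveTree 1
  attach : RecursiveTree n → Fin n → RecursiveTree (suc n)

TreeAdj : RecursiveTree n → Rel (Fin n) 0ℓ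
TreeAdj root         _       _       = ⊥
TreeAdj (attach c p) zero    zero    = ⊥
TreeAdj (attach c p) zero    (suc v) = v ≡ p
TreeAdj (attach c p) (suc u) zero    = u ≡ p
TreeAdj (attach c p) (suc u) (suc v) = TreeAdj c u v

treeAdj? : (c : RecursiveTree n) → Decidable (TreeAdj c)
treeAdj? root         _       _       = no λ ()
treeAdj? (attach c p) zero    zero    = no λ ()
treeAdj? (attach c p) zero    (suc v) = v ≟ p
treeAdj? (attach c p) (suc u) zero    = u ≟ p
treeAdj? (attach c p) (suc u) (suc v) = treeAdj? c u v

treeAdj-sym : (c : RecursiveTree n) → Symmetric (TreeAdj c)
treeAdj-sym (attach c p) {zero}  {suc v} v≡p = v≡p
treeAdj-sym (attach c p) {suc u} {zero}  u≡p = u≡p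
treeAdj-sym (attach c p) {suc u} {suc v} uv  = treeAdj-sym c uv

treeAdj-irrefl : (c : RecursiveTree n) → Irreflexive _≡_ (TreeAdj c)
treeAdj-irrefl (attach c p) {suc u} refl uu = treeAdj-irrefl c refl uu

treeGraph : RecursiveTree n → SimpleGraph n
treeGraph c = record
  { graph    = record { Adj = TreeAdj c ; adj? = treeAdj? c ; adj-sym = treeAdj-sym c }
  ; loopless = treeAdj-irrefl c
  }

-- `graft t s` joins the roots of `t` and `s` by a new edge and keeps the root of `t`, so `arity` is
-- the degree of the root.
data RootedTree : Set where
  single : RootedTree
  graft  : (parent child : RootedTree) → RootedTree

edges : RootedTree → ℕ
edges single      = 0
edges (graft t s) = edges t + suc (edges s)

arity : RootedTree → ℕ
arity single      = 0
arity (graft t s) = suc (arity t)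

-- Folds the vertices, newest first, into the tree decorating their parent.
collapse : RecursiveTree n → (Fin n → RootedTree) → RootedTree
collapse root         T = T zero
collapse (attach c p) T = collapse c (updateAt (tail T) p (λ t → graft t (T zero)))

rootedTree : RecursiveTree n → RootedTree
rootedTree c = collapse c (const single)

sum-edges-updateAt : (g : Fin n → RootedTree) (p : Fin n) (s : RootedTree) →
               ∑[ i < n ] edges (updateAt g p (λ t → graft t s) i) ≡ suc (edges s) + ∑[ i < n ] edges (g i)
sum-edges-updateAt g zero    s = shift (edges (g zero)) (edges s) _
  where
  shift : ∀ a b c → (a + suc b) + c ≡ suc b + (a + c)
  shift = solve-∀
sum-edges-updateAt g (suc p) s = trans (cong (edges (g zero) +_) (sum-edges-updateAt (g ∘ suc) p s))
  (shift (edges (g zero)) (edges s) _)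
  where
  shift : ∀ a b c → a + (suc b + c) ≡ suc b + (a + c)
  shift = solve-∀

edges-collapse : (c : RecursiveTree (suc n)) (T : Fin (suc n) → RootedTree) →
                 edges (collapse c T) ≡ n + ∑[ i < suc n ] edges (T i)
edges-collapse root T = sym (+-identityʳ _)
edges-collapse {suc n} (attach c p) T = begin
  edges (collapse c T′)                            ≡⟨ edges-collapse c T′ ⟩
  n + ∑[ i < suc n ] edges (T′ i)                  ≡⟨ cong (n +_) (sum-edges-updateAt (tail T) p (T zero)) ⟩
  n + suc (∑[ i < suc (suc n) ] edges (T i))       ≡⟨ +-suc n _ ⟩
  suc n + ∑[ i < suc (suc n) ] edges (T i)         ∎
  where
  open ≡-Reasoning
  T′ = updateAt (tail T) p (λ t → graft t (T zero))

edges-rootedTree : (c : RecursiveTree (suc n)) → edges (rootedTree c) ≡ n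
edges-rootedTree {n} c = trans (edges-collapse c _) (trans (cong (n +_) (sum-replicate-zero (suc n))) (+-identityʳ n))

module Walks (H : Graph k) where
  open Graph H

  M : (Fin k → ℕ) → Fin k → ℕ
  M f i = ∑[ j < k ] (𝟙 (adj? i j) * f j)

  M-cong : ∀ {f g} → f ≗ g → M f ≗ M g
  M-cong eq i = sum-cong-≗ λ j → cong (𝟙 (adj? i j) *_) (eq j)

  -- colorings t i is the number of H-colorings of t with the root sent to i.
  colorings : RootedTree → Fin k → ℕ
  colorings single      i = 1
  colorings (graft t s) i = colorings t i * M (colorings s) i

  -- Identify the root of each `T i` with vertex `i` of `c`: this is the number of colorings of the
  -- resulting tree that restrict to `f` on `c`.
  weight : RecursiveTree n → (Fin n → RootedTree) → (Fin n → Fin k) → ℕ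
  weight c T f = 𝟙 (isColoring? (treeGraph c) H f) * product (λ i → colorings (T i) (f i))

  weight-ext : (c : RecursiveTree n) (T : Fin n → RootedTree) → Extensional (weight c T)
  weight-ext c T eq = cong₂ _*_ (𝟙-coloring-ext {G = treeGraph c} {H} eq)
                                (product-cong-≗ λ i → cong (colorings (T i)) (eq i))

  product-colorings-updateAt : (T : Fin n → RootedTree) (p : Fin n) (s : RootedTree) (f : Fin n → Fin k) →
    product (λ i → colorings (updateAt T p (λ t → graft t s) i) (f i)) ≡
    M (colorings s) (f p) * product (λ i → colorings (T i) (f i))
  product-colorings-updateAt T zero    s f = shift (colorings (T zero) (f zero)) (M (colorings s) (f zero)) _
    where
    shift : ∀ a b c → (a * b) * c ≡ b * (a * c)
    shift = solve-∀
  product-colorings-updateAt T (suc p) s f =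
    trans (cong (colorings (T zero) (f zero) *_) (product-colorings-updateAt (T ∘ suc) p s (f ∘ suc)))
          (shift (colorings (T zero) (f zero)) (M (colorings s) (f (suc p))) _)
    where
    shift : ∀ a b c → a * (b * c) ≡ b * (a * c)
    shift = solve-∀

  -- The newest vertex is a leaf, so within `c` its color is constrained only by that of `p`.
  𝟙-coloring-attach : (c : RecursiveTree n) (p : Fin n) (a : Fin k) (f : Fin n → Fin k) →
    𝟙 (isColoring? (treeGraph (attach c p)) H (a ∷ᶠ f)) ≡
    𝟙 (adj? (f p) a) * 𝟙 (isColoring? (treeGraph c) H f)
  𝟙-coloring-attach c p a f =
    trans (𝟙-cong (isColoring? (treeGraph (attach c p)) H (a ∷ᶠ f))
                  (adj? (f p) a ×-dec isColoring? (treeGraph c) H f) (mk⇔ split merge))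
          (𝟙-× (adj? (f p) a) (isColoring? (treeGraph c) H f))
    where
    split : IsColoring (treeGraph (attach c p)) H (a ∷ᶠ f) → Adj (f p) a × IsColoring (treeGraph c) H f
    split col = col (suc p) zero refl , λ u v → col (suc u) (suc v)
    merge : Adj (f p) a × IsColoring (treeGraph c) H f → IsColoring (treeGraph (attach c p)) H (a ∷ᶠ f)
    merge (pa , col) zero    (suc v) refl = adj-sym pa
    merge (pa , col) (suc u) zero    refl = pa
    merge (pa , col) (suc u) (suc v) uv   = col u v uv

  -- Induction by removing the newest vertex. Summing over its color `a` turns its edge and its
  -- decoration into the factor `M (colorings (T zero)) (f p)`, which is exactly what grafting
  -- `T zero` onto the decoration of `p` contributes.
  ∑-weight : (c : RecursiveTree n) (T : Fin n → RootedTree) →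
             ∑maps (weight c T) ≡ ∑[ a < k ] colorings (collapse c T) a
  ∑-weight root T = trans (∑maps-suc _ (weight-ext root T)) (sum-cong-≗ λ a → simplify (colorings (T zero) a) a)
    where
    simplify : ∀ w a → 𝟙 (isColoring? (treeGraph root) H (a ∷ᶠ finToFun zero)) * (w * 1) + 0 ≡ w
    simplify w a rewrite 𝟙-true (isColoring? (treeGraph root) H (a ∷ᶠ finToFun zero)) (λ _ _ ()) =
      trans (+-identityʳ _) (trans (*-identityˡ _) (*-identityʳ w))
  ∑-weight {suc n} (attach c p) T = begin
    ∑maps (weight (attach c p) T)
      ≡⟨ ∑maps-suc _ (weight-ext (attach c p) T) ⟩
    ∑[ a < k ] ∑maps (λ f → weight (attach c p) T (a ∷ᶠ f))
      ≡⟨ ∑-comm (λ a b → weight (attach c p) T (a ∷ᶠ finToFun b)) ⟩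
    ∑maps (λ f → ∑[ a < k ] weight (attach c p) T (a ∷ᶠ f))
      ≡⟨ sum-cong-≗ (λ b → absorb (finToFun b)) ⟩
    ∑maps (weight c T′)
      ≡⟨ ∑-weight c T′ ⟩
    ∑[ a < k ] colorings (collapse c T′) a ∎
    where
    open ≡-Reasoning
    T′ = updateAt (tail T) p (λ t → graft t (T zero))
    shift : ∀ a b c d → (a * b) * (c * d) ≡ (a * c) * (b * d)
    shift = solve-∀
    shift′ : ∀ a b c → a * (b * c) ≡ b * (a * c)
    shift′ = solve-∀
    absorb : ∀ f → ∑[ a < k ] weight (attach c p) T (a ∷ᶠ f) ≡ weight c T′ f
    absorb f = begin
      ∑[ a < k ] weight (attach c p) T (a ∷ᶠ f)
        ≡⟨ sum-cong-≗ (λ a → trans (cong (_* (colorings (T zero) a * P)) (𝟙-coloring-attach c p a f))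
                                   (shift (𝟙 (adj? (f p) a)) C (colorings (T zero) a) P)) ⟩
      ∑[ a < k ] (𝟙 (adj? (f p) a) * colorings (T zero) a * (C * P))
        ≡⟨ *-distribʳ-sum (C * P) (λ a → 𝟙 (adj? (f p) a) * colorings (T zero) a) ⟨
      M (colorings (T zero)) (f p) * (C * P)
        ≡⟨ shift′ (M (colorings (T zero)) (f p)) C P ⟩
      C * (M (colorings (T zero)) (f p) * P)
        ≡⟨ cong (C *_) (product-colorings-updateAt (tail T) p (T zero) f) ⟨
      weight c T′ f ∎
      where
      C = 𝟙 (isColoring? (treeGraph c) H f)
      P = product (λ i → colorings (T (suc i)) (f i))

  hom-treeGraph : (c : RecursiveTree n) → hom (treeGraph c) H ≡ ∑[ a < k ] colorings (rootedTree c) a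
  hom-treeGraph {n} c = trans (hom-∑maps (treeGraph c) H) (trans (sum-cong-≗ λ i → unweighted (finToFun i)) (∑-weight c _))
    where
    product-1 : ∀ n → product {n} (λ _ → 1) ≡ 1
    product-1 zero    = refl
    product-1 (suc n) = trans (*-identityˡ _) (product-1 n)
    unweighted : ∀ f → 𝟙 (isColoring? (treeGraph c) H f) ≡ weight c (const single) f
    unweighted f = sym (trans (cong (𝟙 (isColoring? (treeGraph c) H f) *_) (product-1 n)) (*-identityʳ _))

-- Recursive trees exhaust all trees

≅-sym : {G : SimpleGraph n} {G′ : SimpleGraph l} → G ≅ G′ → G′ ≅ G
≅-sym {G = G} {G′} φ = record
  { bijection = ↔-sym bijection
  ; adj-⇔ = λ u v → ⇔-sym (subst₂ (λ u′ v′ → SimpleGraph.Adj G (bijection ⟨$⟩ˡ u) (bijection ⟨$⟩ˡ v) ⇔ SimpleGraph.Adj G′ u′ v′) (inverseʳ bijection) (inverseʳ bijection)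
                            (adj-⇔ (bijection ⟨$⟩ˡ u) (bijection ⟨$⟩ˡ v)))
  }
  where open _≅_ φ

≅-trans : {G : SimpleGraph n} {G′ : SimpleGraph l} {G″ : SimpleGraph k} → G ≅ G′ → G′ ≅ G″ → G ≅ G″
≅-trans φ ψ = record
  { bijection = _≅_.bijection ψ ↔-∘ _≅_.bijection φ
  ; adj-⇔     = λ u v → _≅_.adj-⇔ ψ _ _ ⇔-∘ _≅_.adj-⇔ φ u v
  }

∷-injective : {x : Fin n} {f : Fin k → Fin n} → Injective _≡_ _≡_ f → (∀ i → f i ≢ x) → Injective _≡_ _≡_ (x ∷ᶠ f)
∷-injective f-inj x∉f {zero}  {zero}  _  = refl
∷-injective f-inj x∉f {zero}  {suc j} eq = contradiction (sym eq) (x∉f j)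
∷-injective f-inj x∉f {suc i} {zero}  eq = contradiction eq (x∉f i)
∷-injective f-inj x∉f {suc i} {suc j} eq = cong suc (f-inj eq)

-- Simple paths in recursive trees

record SimplePath (R : Rel (Fin n) 0ℓ) (u v : Fin n) : Set where
  field
    steps       : ℕ
    vertex      : Fin (suc steps) → Fin n
    distinct    : Injective _≡_ _≡_ vertex
    consecutive : ∀ i → R (vertex (inject₁ i)) (vertex (suc i))
    start       : vertex zero ≡ u
    end         : vertex (fromℕ steps) ≡ v

module _ where
  open SimplePath

  singleton : {R : Rel (Fin n) 0ℓ} (u : Fin n) → SimplePath R u u
  singleton u = record
    { steps = 0 ; vertex = const u ; distinct = λ { {zero} {zero} _ → refl } ; consecutive = λ () ; start = refl ; end = refl }

  cons : {R : Rel (Fin n) 0ℓ} {u v w : Fin n} → R u v → (P : SimplePath R v w) → (∀ i → vertex P i ≢ u) → SimplePath R u w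
  cons {R = R} {u} uv P u∉P = record
    { steps       = suc (steps P)
    ; vertex      = u ∷ᶠ vertex P
    ; distinct    = ∷-injective (distinct P) u∉P
    ; consecutive = λ { zero → subst (R u) (sym (start P)) uv ; (suc i) → consecutive P i }
    ; start       = refl
    ; end         = end P
    }

  mapPath : {R : Rel (Fin n) 0ℓ} {S : Rel (Fin l) 0ℓ} (f : Fin n → Fin l) → Injective _≡_ _≡_ f →
            (∀ {u v} → R u v → S (f u) (f v)) → ∀ {u v} → SimplePath R u v → SimplePath S (f u) (f v)
  mapPath f f-inj f-hom P = record
    { steps       = steps P
    ; vertex      = f ∘ vertex P
    ; distinct    = distinct P ∘ f-inj
    ; consecutive = f-hom ∘ consecutive P
    ; start       = cong f (start P)
    ; end         = cong f (end P)
    }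

  opposite-inject₁ : (i : Fin n) → opposite (inject₁ i) ≡ suc (opposite i)
  opposite-inject₁ zero    = refl
  opposite-inject₁ (suc i) = cong inject₁ (opposite-inject₁ i)

  reversePath : {R : Rel (Fin n) 0ℓ} → Symmetric R → ∀ {u v} → SimplePath R u v → SimplePath R v u
  reversePath {R = R} R-sym P = record
    { steps       = steps P
    ; vertex      = vertex P ∘ opposite
    ; distinct    = λ eq → trans (sym (opposite-involutive _)) (trans (cong opposite (distinct P eq)) (opposite-involutive _))
    ; consecutive = λ i → R-sym (subst (λ j → R (vertex P (inject₁ (opposite i))) (vertex P j)) (sym (opposite-inject₁ i))
                                       (consecutive P (opposite i)))
    ; start       = end P
    ; end         = trans (cong (vertex P) (opposite-involutive zero)) (start P)
    }

  treePath : (c : RecursiveTree n) (u v : Fin n) → SimplePath (TreeAdj c) u v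
  treePath root         zero    zero    = singleton zero
  treePath (attach c p) zero    zero    = singleton zero
  treePath (attach c p) zero    (suc v) = cons refl (mapPath suc sucᶠ-injective id (treePath c p v)) (λ i ())
  treePath (attach c p) (suc u) zero    = reversePath (λ {x} {y} → treeAdj-sym (attach c p) {x} {y})
    (cons {R = TreeAdj (attach c p)} refl (mapPath suc sucᶠ-injective id (treePath c p u)) (λ i ()))
  treePath (attach c p) (suc u) (suc v) = mapPath suc sucᶠ-injective id (treePath c u v)

  -- Distinct endpoints force at least one step, so the path together with `x` has the three
  -- vertices that a cycle needs.
  closePath : (G : SimpleGraph n) {a b x : Fin n} → a ≢ b → (P : SimplePath (SimpleGraph.Adj G) a b) →
              (∀ i → vertex P i ≢ x) → SimpleGraph.Adj G x a → SimpleGraph.Adj G x b → Cycle G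
  closePath G a≢b record { steps = zero ; start = start ; end = end } x∉P xa xb =
    contradiction (trans (sym start) end) a≢b
  closePath G {x = x} a≢b P@(record { steps = suc extra }) x∉P xa xb = record
    { extra       = extra
    ; vertex      = vertex Q
    ; distinct    = distinct Q
    ; consecutive = consecutive Q
    ; closing     = subst (λ y → Adj y x) (sym (end Q)) (adj-sym xb)
    }
    where
    open SimpleGraph G
    Q = cons {R = Adj} xa P x∉P

-- Adjacency is reflected as well as preserved, so that a surjective embedding is an isomorphism.
record Embedding (c : RecursiveTree k) (G : SimpleGraph n) : Set where
  field
    ψ           : Fin k → Fin n
    ψ-injective : Injective _≡_ _≡_ ψ
    ψ-adj-⇔     : ∀ u v → TreeAdj c u v ⇔ SimpleGraph.Adj G (ψ u) (ψ v)

-- Were `x` adjacent to a second vertex `ψ q` of the image, the image of the tree path from `q` to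
-- `p` would close up to a cycle through `x`.
extendEmbedding : {G : SimpleGraph n} → ¬ Cycle G → {c : RecursiveTree k} (E : Embedding c G) → let open Embedding E in
  ∀ {x} p → (∀ i → ψ i ≢ x) → SimpleGraph.Adj G x (ψ p) → Embedding (attach c p) G
extendEmbedding {G = G} acyclic {c} E {x} p x∉ψ xp = record
  { ψ           = x ∷ᶠ ψ
  ; ψ-injective = ∷-injective ψ-injective x∉ψ
  ; ψ-adj-⇔     = λ
    { zero    zero    → mk⇔ (λ ()) (loopless refl)
    ; zero    (suc q) → mk⇔ (λ { refl → xp }) (unique q)
    ; (suc q) zero    → mk⇔ (λ { refl → adj-sym xp }) (unique q ∘ adj-sym)
    ; (suc u) (suc v) → ψ-adj-⇔ u v
    }
  }
  where
  open SimpleGraph G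
  open Embedding E
  unique : ∀ q → Adj x (ψ q) → q ≡ p
  unique q xq with q ≟ p
  ... | yes q≡p = q≡p
  ... | no  q≢p = contradiction
    (closePath G (q≢p ∘ ψ-injective) (mapPath ψ ψ-injective (Equivalence.to (ψ-adj-⇔ _ _)) (treePath c q p)) (λ i → x∉ψ _) xq xp)
    acyclic

-- Follows the walk up to the first step that leaves the image of `ψ`.
frontier : {R : Rel (Fin n) 0ℓ} (ψ : Fin k → Fin n) (p : Fin k) {x : Fin n} → Star R (ψ p) x → (∀ i → ψ i ≢ x) →
           ∃₂ λ q y → (∀ i → ψ i ≢ y) × R (ψ q) y
frontier ψ p ε x∉ψ = contradiction refl (x∉ψ p)
frontier {R = R} ψ p (_◅_ {j = y} py walk) x∉ψ with any? (λ i → ψ i ≟ y)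
... | yes (q , refl) = frontier ψ q walk x∉ψ
... | no  y∉ψ        = p , y , (λ i eq → y∉ψ (i , eq)) , py

rootVertex : RecursiveTree n → Fin n
rootVertex root         = zero
rootVertex (attach c p) = suc (rootVertex c)

-- The root is prescribed because the strict inequality needs the tree rooted at a vertex of degree
-- at least 3.
Spanning : SimpleGraph n → Fin n → Set
Spanning G r = ∃ λ k → Σ[ c ∈ RecursiveTree k ] Σ[ φ ∈ treeGraph c ≅ G ] _≅_.to φ (rootVertex c) ≡ r

-- `d` bounds the number of vertices still missing. When it is 0, one more extension would inject
-- `suc k` vertices into `n ≤ k`.
grow : {G : SimpleGraph n} → IsTree G → ∀ d {c : RecursiveTree k} (E : Embedding c G) → n ≤ d + k →
       Spanning G (Embedding.ψ E (rootVertex c))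
grow {n} {k} {G} tree d {c} E n≤d+k with all? (λ x → any? (λ i → Embedding.ψ E i ≟ x))
... | yes ψ-surjective = k , c , record
  { bijection = permutation ψ (proj₁ ∘ ψ-surjective) (proj₂ ∘ ψ-surjective) (λ i → ψ-injective (proj₂ (ψ-surjective (ψ i))))
  ; adj-⇔     = ψ-adj-⇔
  } , refl
  where open Embedding E
... | no ¬surjective
  with x , x∉ψ ← ¬∀⟶∃¬ n _ (λ x → any? (λ i → Embedding.ψ E i ≟ x)) ¬surjective
  with p , y , y∉ψ , py ← frontier (Embedding.ψ E) (rootVertex c) (IsTree.connected tree _ x) (λ i eq → x∉ψ (i , eq))
  with d
...   | zero  = contradiction
  (≤-trans (injective⇒≤ (Embedding.ψ-injective (extendEmbedding (IsTree.acyclic tree) E p y∉ψ (SimpleGraph.adj-sym G py)))) n≤d+k) 1+n≰n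
...   | suc d = grow tree d (extendEmbedding (IsTree.acyclic tree) E p y∉ψ (SimpleGraph.adj-sym G py))
  (≤-trans n≤d+k (≤-reflexive (sym (+-suc d k))))

spanning : {G : SimpleGraph n} → IsTree G → ∀ r → Spanning G r
spanning {n} {G} tree r = grow tree n E (m≤m+n n 1)
  where
  E : Embedding root G
  E = record
    { ψ           = const r
    ; ψ-injective = λ { {zero} {zero} _ → refl }
    ; ψ-adj-⇔     = λ _ _ → mk⇔ (λ ()) (SimpleGraph.loopless G refl)
    }

-- Vertices of degree at least three

record Branching (G : SimpleGraph n) : Set where
  field
    centre     : Fin n
    neighbour  : Fin 3 → Fin n
    distinct   : Injective _≡_ _≡_ neighbour
    centre-adj : ∀ i → SimpleGraph.Adj G centre (neighbour i)

Branching-map : {G : SimpleGraph n} {G′ : SimpleGraph l} (f : Fin n → Fin l) → Injective _≡_ _≡_ f →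
  (∀ {u v} → SimpleGraph.Adj G u v → SimpleGraph.Adj G′ (f u) (f v)) → Branching G → Branching G′
Branching-map f f-inj f-hom B = record
  { centre     = f centre
  ; neighbour  = f ∘ neighbour
  ; distinct   = distinct ∘ f-inj
  ; centre-adj = f-hom ∘ centre-adj
  }
  where open Branching B

↔-injective : (π : Permutation n l) → Injective _≡_ _≡_ (π ⟨$⟩ʳ_)
↔-injective π eq = trans (sym (inverseˡ π)) (trans (cong (π ⟨$⟩ˡ_) eq) (inverseˡ π))

suc-PathAdj : ∀ u v → PathAdj n u v ⇔ PathAdj (suc n) (suc u) (suc v)
suc-PathAdj u v = mk⇔ (λ { (inj₁ p) → inj₁ (cong suc p) ; (inj₂ p) → inj₂ (cong suc p) })
                      (λ { (inj₁ p) → inj₁ (suc-injective p) ; (inj₂ p) → inj₂ (suc-injective p) })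

-- The new leaf takes position `zero` and every older vertex moves up by one, which matches `lift₀`.
prolong : {c : RecursiveTree n} {p : Fin n} (φ : treeGraph c ≅ path (suc l)) → _≅_.to φ p ≡ zero →
          treeGraph (attach c p) ≅ path (suc (suc l))
prolong {p = p} φ φp≡0 = record
  { bijection = lift₀ bijection
  ; adj-⇔     = λ
    { zero    zero    → mk⇔ (λ ()) (λ { (inj₁ ()) ; (inj₂ ()) })
    ; zero    (suc v) → mk⇔ (λ v≡p → inj₁ (cong suc (sym (cong toℕ (toEnd v≡p))))) (λ { (inj₁ eq) → fromEnd (sym (suc-injective eq)) ; (inj₂ ()) })
    ; (suc u) zero    → mk⇔ (λ u≡p → inj₂ (cong suc (sym (cong toℕ (toEnd u≡p))))) (λ { (inj₁ ()) ; (inj₂ eq) → fromEnd (sym (suc-injective eq)) })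
    ; (suc u) (suc v) → suc-PathAdj _ _ ⇔-∘ adj-⇔ u v
    }
  }
  where
  open _≅_ φ
  toEnd : ∀ {v} → v ≡ p → to v ≡ zero
  toEnd refl = φp≡0
  fromEnd : ∀ {v} → toℕ (to v) ≡ 0 → v ≡ p
  fromEnd eq = ↔-injective bijection (trans (toℕ-injective eq) (sym φp≡0))

opposite-PathAdj : ∀ (u v : Fin n) → suc (toℕ u) ≡ toℕ v → suc (toℕ (opposite v)) ≡ toℕ (opposite u)
opposite-PathAdj {n} u v eq = begin
  suc (toℕ (opposite v))    ≡⟨ cong suc (opposite-prop v) ⟩
  suc (n ∸ suc (toℕ v))     ≡⟨ +-∸-assoc 1 (toℕ<n v) ⟨
  n ∸ toℕ v                 ≡⟨ cong (n ∸_) eq ⟨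
  n ∸ suc (toℕ u)           ≡⟨ opposite-prop u ⟨
  toℕ (opposite u)          ∎
  where open ≡-Reasoning

reverse≅ : path n ≅ path n
reverse≅ = record
  { bijection = reverse
  ; adj-⇔     = λ u v → mk⇔ (flip u v) (λ uv → subst₂ (PathAdj _) (opposite-involutive u) (opposite-involutive v)
                                                      (flip (opposite u) (opposite v) uv))
  }
  where
  flip : ∀ u v → PathAdj _ u v → PathAdj _ (opposite u) (opposite v)
  flip u v (inj₁ eq) = inj₂ (opposite-PathAdj u v eq)
  flip u v (inj₂ eq) = inj₁ (opposite-PathAdj v u eq)

root≅path : treeGraph root ≅ path 1
root≅path = record
  { bijection = ↔-id _
  ; adj-⇔     = λ { zero zero → mk⇔ (λ ()) (λ { (inj₁ ()) ; (inj₂ ()) }) }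
  }

-- If the older vertices form a path, the new leaf either prolongs it at one of its ends, the far
-- end after a reversal, or hangs from an inner vertex, which then has three neighbours.
pathOrBranching : (c : RecursiveTree (suc n)) → treeGraph c ≅ path (suc n) ⊎ Branching (treeGraph c)
pathOrBranching root = inj₁ root≅path
pathOrBranching {suc n} (attach c p) with pathOrBranching c
... | inj₂ B = inj₂ (Branching-map suc sucᶠ-injective id B)
... | inj₁ φ with _≅_.to φ p in eq
...   | zero  = inj₁ (prolong φ eq)
-- `p` sits at position `suc y`; the test asks whether that is the last position `n`.
...   | suc y with suc (suc (toℕ y)) ≟ℕ suc n
...     | yes last = inj₁ (prolong (≅-trans φ reverse≅) (trans (cong opposite eq) (toℕ-injective
            (trans (opposite-prop (suc y)) (trans (cong (suc n ∸_) last) (n∸n≡0 n))))))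
...     | no ¬last = inj₂ record
          { centre     = suc p
          ; neighbour  = zero ∷ᶠ f
          ; distinct   = ∷-injective (λ { {zero} {zero} _ → refl ; {suc zero} {suc zero} _ → refl
                                        ; {zero} {suc zero} e → contradiction e a≢b
                                        ; {suc zero} {zero} e → contradiction (sym e) a≢b })
                                     (λ { zero () ; (suc zero) () })
          ; centre-adj = λ { zero → refl ; (suc zero) → adjacent (inj₂ (cong suc (toℕ-inject₁ y)))
                           ; (suc (suc zero)) → adjacent (inj₁ (sym (toℕ-fromℕ< z<n))) }
          }
          where
          open _≅_ φ using (bijection; adj-⇔)
          z<n : suc (suc (toℕ y)) < suc n
          z<n = ≤∧≢⇒< (s≤s (toℕ<n y)) ¬last
          below above : Fin (suc n)
          below = inject₁ y
          above = fromℕ< z<n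
          f : Fin 2 → Fin (suc (suc n))
          f zero    = suc (bijection ⟨$⟩ˡ below)
          f (suc _) = suc (bijection ⟨$⟩ˡ above)
          a≢b : f zero ≢ f (suc zero)
          a≢b e = m≢1+m+n (toℕ y) {1} (trans (sym (toℕ-inject₁ y)) (trans (cong toℕ (↔-injective (↔-sym bijection) (sucᶠ-injective e)))
                    (trans (toℕ-fromℕ< z<n) (cong suc (+-comm 1 _)))))
          adjacent : ∀ {q} → PathAdj (suc n) (suc y) q → TreeAdj c p (bijection ⟨$⟩ˡ q)
          adjacent {q} pq = Equivalence.from (adj-⇔ p _) (subst₂ (PathAdj _) (sym eq) (sym (inverseʳ bijection)) pq)

arity-updateAt : (T : Fin n → RootedTree) (p j : Fin n) (s : RootedTree) → arity (T j) ≤ arity (updateAt T p (λ t → graft t s) j)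
arity-updateAt T zero    zero    s = n≤1+n _
arity-updateAt T zero    (suc j) s = ≤-refl
arity-updateAt T (suc p) zero    s = ≤-refl
arity-updateAt T (suc p) (suc j) s = arity-updateAt (T ∘ suc) p j s

-- The root is the oldest vertex, so each of its neighbours was attached directly to it and is
-- folded into a branch of its own. The function `f` lists the neighbours not yet folded; once the
-- newest vertex is folded, it is dropped from the list and the arity has grown by one.
arity-collapse : (c : RecursiveTree n) (T : Fin n → RootedTree) (f : Fin k → Fin n) → Injective _≡_ _≡_ f →
  (∀ i → TreeAdj c (rootVertex c) (f i)) → k + arity (T (rootVertex c)) ≤ arity (collapse c T)
arity-collapse {k = zero}  root T f f-inj adj = ≤-refl
arity-collapse {k = suc k} root T f f-inj adj = ⊥-elim (adj zero)
arity-collapse {k = k} (attach c p) T f f-inj adj with any? (λ i → f i ≟ zero)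
... | no  0∉f      = ≤-trans (+-monoʳ-≤ k (arity-updateAt (tail T) p (rootVertex c) (T zero)))
  (arity-collapse c T′ g (λ eq → f-inj (punchOut-injective (≢0 _) (≢0 _) eq))
    (λ i → subst (TreeAdj (attach c p) (suc (rootVertex c))) (sym (punchIn-punchOut (≢0 i))) (adj i)))
  where
  T′ = updateAt (tail T) p (λ t → graft t (T zero))
  ≢0 : ∀ i → zero ≢ f i
  ≢0 i eq = 0∉f (i , sym eq)
  g = λ i → punchOut (≢0 i)
arity-collapse {k = suc k} (attach c p) T f f-inj adj | yes (i , fi≡0)
  -- Adjacency of the root to `zero` unfolds to `rootVertex c ≡ p`.
  with refl ← subst (TreeAdj (attach c p) (suc (rootVertex c))) fi≡0 (adj i) =
  ≤-trans (≤-reflexive (trans (sym (+-suc k _)) (cong (k +_) (sym (cong arity (updateAt-updates p (tail T)))))))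
  (arity-collapse c T′ g (λ eq → punchIn-injective i _ _ (f-inj (punchOut-injective (≢0 _) (≢0 _) eq)))
    (λ j → subst (TreeAdj (attach c p) (suc p)) (sym (punchIn-punchOut (≢0 j))) (adj (punchIn i j))))
  where
  T′ = updateAt (tail T) p (λ t → graft t (T zero))
  ≢0 : ∀ j → zero ≢ f (punchIn i j)
  ≢0 j eq = punchInᵢ≢i i j (f-inj (trans (sym eq) (sym fi≡0)))
  g = λ j → punchOut (≢0 j)

-- Recursive trees are connected and acyclic

treeGraph-connected : (c : RecursiveTree n) (u v : Fin n) → Star (TreeAdj c) u v
treeGraph-connected root         zero    zero    = ε
treeGraph-connected (attach c p) zero    zero    = ε
treeGraph-connected (attach c p) zero    (suc v) = _◅_ {j = suc p} refl (gmap suc id (treeGraph-connected c p v))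
treeGraph-connected (attach c p) (suc u) zero    = gmap suc id (treeGraph-connected c u p) ◅◅ (_◅_ {j = zero} refl ε)
treeGraph-connected (attach c p) (suc u) (suc v) = gmap suc id (treeGraph-connected c u v)

module _ {G : SimpleGraph n} (C : Cycle G) where
  open SimpleGraph G
  open Cycle C

  cycle-neighbours : ∀ i → ∃₂ λ j k → j ≢ k × Adj (vertex i) (vertex j) × Adj (vertex i) (vertex k)
  cycle-neighbours zero = suc zero , fromℕ (suc (suc extra)) , (λ ()) , consecutive zero , adj-sym closing
  cycle-neighbours (suc j) with view j
  ... | ‵fromℕ      = _ , zero , (λ ()) , adj-sym (consecutive (fromℕ (suc extra))) , closing
  ... | ‵inject₁ j′ = inject₁ (inject₁ j′) , suc (suc j′) , distant , adj-sym (consecutive (inject₁ j′)) , consecutive (suc j′)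
    where
    distant : inject₁ (inject₁ j′) ≢ suc (suc j′)
    distant eq = m≢1+m+n (toℕ j′) {1} (trans (sym (trans (toℕ-inject₁ (inject₁ j′)) (toℕ-inject₁ j′)))
                   (trans (cong toℕ eq) (cong suc (+-comm 1 _))))

-- The newest vertex has a single neighbour, whereas a vertex on a cycle has two; hence a cycle
-- avoids it and already lies in `c`.
treeGraph-acyclic : (c : RecursiveTree n) → ¬ Cycle (treeGraph c)
treeGraph-acyclic root         C = Cycle.consecutive C zero
treeGraph-acyclic (attach c p) C with any? (λ i → Cycle.vertex C i ≟ zero)
... | yes (i , vi≡0) with j , k , j≢k , ij , ik ← cycle-neighbours C i =
  j≢k (Cycle.distinct C (trans (parent (vertex i) (vertex j) vi≡0 ij) (sym (parent (vertex i) (vertex k) vi≡0 ik))))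
  where
  open Cycle C using (vertex)
  parent : ∀ u v → u ≡ zero → TreeAdj (attach c p) u v → v ≡ suc p
  parent zero (suc v) refl refl = refl
... | no 0∉C = treeGraph-acyclic c record
  { extra       = extra
  ; vertex      = λ i → punchOut (≢0 i)
  ; distinct    = λ eq → distinct (punchOut-injective (≢0 _) (≢0 _) eq)
  ; consecutive = λ i → lower (consecutive i)
  ; closing     = lower closing
  }
  where
  open Cycle C
  ≢0 : ∀ i → zero ≢ vertex i
  ≢0 i eq = 0∉C (i , sym eq)
  lower : ∀ {i j} → TreeAdj (attach c p) (vertex i) (vertex j) → TreeAdj c (punchOut (≢0 i)) (punchOut (≢0 j))
  lower {i} {j} = subst₂ (TreeAdj (attach c p)) (sym (punchIn-punchOut (≢0 i))) (sym (punchIn-punchOut (≢0 j)))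

treeGraph-isTree : (c : RecursiveTree (suc n)) → IsTree (treeGraph c)
treeGraph-isTree c = record
  { nonEmpty  = s≤s z≤n
  ; connected = treeGraph-connected c
  ; acyclic   = treeGraph-acyclic c
  }

-- Chebyshev's inequality

sum-mono-≤ : {f g : Fin n → ℕ} → (∀ i → f i ≤ g i) → sum f ≤ sum g
sum-mono-≤ {zero}  f≤g = z≤n
sum-mono-≤ {suc n} f≤g = +-mono-≤ (f≤g zero) (sum-mono-≤ (f≤g ∘ suc))

sum-mono-< : {f g : Fin n → ℕ} → (∀ i → f i ≤ g i) → ∀ i → f i < g i → sum f < sum g
sum-mono-< f≤g zero    fi<gi = +-mono-<-≤ fi<gi (sum-mono-≤ (f≤g ∘ suc))
sum-mono-< f≤g (suc i) fi<gi = +-mono-≤-< (f≤g zero) (sum-mono-< (f≤g ∘ suc) i fi<gi)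

-- This is (b - a)(d - c) ≥ 0 without subtraction, `p` and `q` being the two differences.
rearrangement-≤ : ∀ {a b c d} → a ≤ b → c ≤ d → a * d + b * c ≤ a * c + b * d
rearrangement-≤ {a} {c = c} a≤b c≤d with p , refl ← m≤n⇒∃[o]m+o≡n a≤b | q , refl ← m≤n⇒∃[o]m+o≡n c≤d =
  ≤-trans (m≤m+n _ (p * q)) (≤-reflexive (eq a c p q))
  where
  eq : ∀ a c p q → a * (c + q) + (a + p) * c + p * q ≡ a * c + (a + p) * (c + q)
  eq = solve-∀

rearrangement-< : ∀ {a b c d} → a < b → c < d → a * d + b * c < a * c + b * d
rearrangement-< {a} {c = c} a<b c<d with p , refl ← m≤n⇒∃[o]m+o≡n a<b | q , refl ← m≤n⇒∃[o]m+o≡n c<d =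
  m+n≤o⇒m≤o _ (≤-reflexive (eq a c p q))
  where
  eq : ∀ a c p q → suc (a * (suc c + q) + (suc a + p) * c) + (p + q + p * q) ≡ a * c + (suc a + p) * (suc c + q)
  eq = solve-∀

module _ (H : Graph k) where
  open Graph H
  open Walks H

  ⟨_,_⟩ : (Fin k → ℕ) → (Fin k → ℕ) → ℕ
  ⟨ f , g ⟩ = ∑[ i < k ] (f i * g i)

  ⟨⟩-comm : ∀ f g → ⟨ f , g ⟩ ≡ ⟨ g , f ⟩
  ⟨⟩-comm f g = sum-cong-≗ λ i → *-comm (f i) (g i)

  ⟨⟩-congʳ : ∀ f {g h} → g ≗ h → ⟨ f , g ⟩ ≡ ⟨ f , h ⟩
  ⟨⟩-congʳ f eq = sum-cong-≗ λ i → cong (f i *_) (eq i)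

  ⟨⟩-identityˡ : ∀ f → ⟨ const 1 , f ⟩ ≡ sum f
  ⟨⟩-identityˡ f = sum-cong-≗ {k} {λ i → 1 * f i} {f} λ i → *-identityˡ (f i)

  ⟨⟩-rotate : ∀ f (g h : Fin k → ℕ) → ⟨ f , (λ i → g i * h i) ⟩ ≡ ⟨ (λ i → f i * h i) , g ⟩
  ⟨⟩-rotate f g h = sum-cong-≗ λ i → shift (f i) (g i) (h i)
    where
    shift : ∀ a b c → a * (b * c) ≡ (a * c) * b
    shift = solve-∀

  𝟙-adj-sym : ∀ i j → 𝟙 (adj? i j) ≡ 𝟙 (adj? j i)
  𝟙-adj-sym i j = 𝟙-cong (adj? i j) (adj? j i) (mk⇔ adj-sym adj-sym)

  M-selfAdjoint : ∀ f g → ⟨ f , M g ⟩ ≡ ⟨ M f , g ⟩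
  M-selfAdjoint f g = begin
    ∑[ i < k ] (f i * M g i)
      ≡⟨ sum-cong-≗ (λ i → *-distribˡ-sum (f i) (λ j → 𝟙 (adj? i j) * g j)) ⟩
    ∑[ i < k ] ∑[ j < k ] (f i * (𝟙 (adj? i j) * g j))
      ≡⟨ ∑-comm (λ i j → f i * (𝟙 (adj? i j) * g j)) ⟩
    ∑[ j < k ] ∑[ i < k ] (f i * (𝟙 (adj? i j) * g j))
      ≡⟨ sum-cong-≗ (λ j → sum-cong-≗ λ i →
           trans (shift (f i) (𝟙 (adj? i j)) (g j)) (cong (λ e → e * f i * g j) (𝟙-adj-sym i j))) ⟩
    ∑[ j < k ] ∑[ i < k ] (𝟙 (adj? j i) * f i * g j)
      ≡⟨ sum-cong-≗ (λ j → *-distribʳ-sum (g j) (λ i → 𝟙 (adj? j i) * f i)) ⟨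
    ∑[ j < k ] (M f j * g j) ∎
    where
    open ≡-Reasoning
    shift : ∀ a b c → a * (b * c) ≡ b * a * c
    shift = solve-∀

  M-+ : ∀ f g i → M (λ j → f j + g j) i ≡ M f i + M g i
  M-+ f g i = trans (sum-cong-≗ λ j → *-distribˡ-+ (𝟙 (adj? i j)) (f j) (g j))
                    (∑-distrib-+ (λ j → 𝟙 (adj? i j) * f j) (λ j → 𝟙 (adj? i j) * g j))

  M-* : ∀ c f i → M (λ j → c * f j) i ≡ c * M f i
  M-* c f i = trans (sum-cong-≗ λ j → shift (𝟙 (adj? i j)) c (f j)) (sym (*-distribˡ-sum c (λ j → 𝟙 (adj? i j) * f j)))
    where
    shift : ∀ a b c → a * (b * c) ≡ b * (a * c)
    shift = solve-∀

  M-mono-≤ : ∀ {f g} → (∀ j → f j ≤ g j) → ∀ i → M f i ≤ M g i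
  M-mono-≤ f≤g i = sum-mono-≤ λ j → *-monoʳ-≤ (𝟙 (adj? i j)) (f≤g j)

  M-mono-< : ∀ {f g} → (∀ j → f j ≤ g j) → ∀ {i j} → Adj i j → f j < g j → M f i < M g i
  M-mono-< {f} {g} f≤g {i} {j} ij fj<gj = sum-mono-< (λ j → *-monoʳ-≤ (𝟙 (adj? i j)) (f≤g j)) j
    (subst (λ e → e * f j < e * g j) (sym (𝟙-true (adj? i j) ij)) (*-monoʳ-< 1 fj<gj))

  M^ : ℕ → (Fin k → ℕ) → Fin k → ℕ
  M^ zero    f = f
  M^ (suc a) f = M (M^ a f)

  M^-cong : ∀ a {f g} → f ≗ g → M^ a f ≗ M^ a g
  M^-cong zero    eq = eq
  M^-cong (suc a) eq = M-cong (M^-cong a eq)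

  M^-suc : ∀ a f → M^ a (M f) ≗ M^ (suc a) f
  M^-suc zero    f i = refl
  M^-suc (suc a) f   = M-cong (M^-suc a f)

  -- The order `b + a` agrees with `edges (graft t s)`, where the edges of the parent come first.
  M^-compose : ∀ a b f → M^ a (M^ b f) ≗ M^ (b + a) f
  M^-compose zero    b f i rewrite +-identityʳ b = refl
  M^-compose (suc a) b f i rewrite +-suc b a = M-cong (M^-compose a b f) i

  M^-selfAdjoint : ∀ a f g → ⟨ f , M^ a g ⟩ ≡ ⟨ M^ a f , g ⟩
  M^-selfAdjoint zero    f g = refl
  M^-selfAdjoint (suc a) f g = trans (M-selfAdjoint f (M^ a g)) (trans (M^-selfAdjoint a (M f) g)
    (trans (⟨⟩-comm _ g) (trans (⟨⟩-congʳ g (M^-suc a f)) (⟨⟩-comm g _))))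

  M^-+ : ∀ a f g → M^ a (λ j → f j + g j) ≗ (λ i → M^ a f i + M^ a g i)
  M^-+ zero    f g i = refl
  M^-+ (suc a) f g i = trans (M-cong (M^-+ a f g) i) (M-+ (M^ a f) (M^ a g) i)

  M^-* : ∀ a c f → M^ a (λ j → c * f j) ≗ (λ i → c * M^ a f i)
  M^-* zero    c f i = refl
  M^-* (suc a) c f i = trans (M-cong (M^-* a c f) i) (M-* c (M^ a f) i)

  M^-mono-≤ : ∀ a {f g} → (∀ j → f j ≤ g j) → ∀ i → M^ a f i ≤ M^ a g i
  M^-mono-≤ zero    f≤g = f≤g
  M^-mono-≤ (suc a) f≤g = M-mono-≤ (M^-mono-≤ a f≤g)

  -- At `i`, the number of walks with `a` steps from `i`, that is, of colorings of a path with `a`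
  -- edges whose first vertex is sent to `i`.
  walks : ℕ → Fin k → ℕ
  walks a = M^ a (const 1)

  module Chebyshev (ρ : Fin k → ℕ) where

    -- Ties of `ρ` are included, so a monotone function depends on `ρ` alone. As ranks are linearly
    -- ordered, two monotone functions are similarly ordered at every pair of vertices.
    Monotone : (Fin k → ℕ) → Set
    Monotone f = ∀ {i j} → ρ i ≤ ρ j → f i ≤ f j

    Monotone-* : ∀ {f g} → Monotone f → Monotone g → Monotone (λ i → f i * g i)
    Monotone-* f↑ g↑ i≤j = *-mono-≤ (f↑ i≤j) (g↑ i≤j)

    similarlyOrdered : ∀ {f g} → Monotone f → Monotone g →
                       ∀ i j → f i * g j + f j * g i ≤ f i * g i + f j * g j
    similarlyOrdered {f} {g} f↑ g↑ i j with ≤-total (ρ i) (ρ j)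
    ... | inj₁ i≤j = rearrangement-≤ (f↑ i≤j) (g↑ i≤j)
    ... | inj₂ j≤i = subst₂ _≤_ (+-comm (f j * g i) _) (+-comm (f j * g j) _) (rearrangement-≤ (f↑ j≤i) (g↑ j≤i))

    module _ (a : ℕ) (r s : Fin k → ℕ) where

      private
        -- The difference `diag i j` - `cross i j` is (r i - r j)(s i - s j). Applying `M^ a` in
        -- `j`, evaluating at `i` and summing over `i` weights it with the matrix entries of Mᵃ;
        -- each total below is twice one side of Chebyshev's inequality.
        cross diag : Fin k → Fin k → ℕ
        cross i j = r i * s j + r j * s i
        diag  i j = r i * s i + r j * s j

        rs : Fin k → ℕ
        rs i = r i * s i

        X Y : ℕ
        X = ⟨ r , M^ a s ⟩
        Y = ⟨ r , (λ i → walks a i * s i) ⟩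

        ∑-cross : ∑[ i < k ] M^ a (cross i) i ≡ X + X
        ∑-cross = begin
          ∑[ i < k ] M^ a (cross i) i
            ≡⟨ sum-cong-≗ (λ i → trans (M^-+ a _ _ i) (cong₂ _+_ (M^-* a (r i) s i)
                 (trans (M^-cong a (λ j → *-comm (r j) (s i)) i) (M^-* a (s i) r i)))) ⟩
          ∑[ i < k ] (r i * M^ a s i + s i * M^ a r i)
            ≡⟨ ∑-distrib-+ (λ i → r i * M^ a s i) (λ i → s i * M^ a r i) ⟩
          X + ⟨ s , M^ a r ⟩
            ≡⟨ cong (X +_) (trans (M^-selfAdjoint a s r) (⟨⟩-comm _ r)) ⟩
          X + X ∎
          where open ≡-Reasoning

        ∑-diag : ∑[ i < k ] M^ a (diag i) i ≡ Y + Y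
        ∑-diag = begin
          ∑[ i < k ] M^ a (diag i) i
            ≡⟨ sum-cong-≗ (λ i → trans (M^-+ a _ rs i) (cong (_+ M^ a rs i)
                 (trans (M^-cong a (λ j → sym (*-identityʳ (rs i))) i) (M^-* a (rs i) (const 1) i)))) ⟩
          ∑[ i < k ] (rs i * walks a i + M^ a rs i)
            ≡⟨ ∑-distrib-+ (λ i → rs i * walks a i) (M^ a rs) ⟩
          ⟨ rs , walks a ⟩ + ∑[ i < k ] M^ a rs i
            ≡⟨ cong (⟨ rs , walks a ⟩ +_) (trans (sym (⟨⟩-identityˡ (M^ a rs)))
                 (trans (M^-selfAdjoint a (const 1) rs) (⟨⟩-comm _ rs))) ⟩
          ⟨ rs , walks a ⟩ + ⟨ rs , walks a ⟩
            ≡⟨ cong (λ y → y + y) (⟨⟩-rotate r (walks a) s) ⟨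
          Y + Y ∎
          where open ≡-Reasoning

      chebyshev : Monotone r → Monotone s → X ≤ Y
      chebyshev r↑ s↑ = *-cancelˡ-≤ 2 (subst₂ _≤_ (double X) (double Y)
        (subst₂ _≤_ ∑-cross ∑-diag (sum-mono-≤ λ i → M^-mono-≤ a (similarlyOrdered r↑ s↑ i) i)))
        where
        double : ∀ x → x + x ≡ 2 * x
        double = solve-∀

      -- All rows satisfy the weak inequality, so strictness in the single row `i` suffices.
      chebyshev-< : Monotone r → Monotone s → ∀ i → M^ a (cross i) i < M^ a (diag i) i → X < Y
      chebyshev-< r↑ s↑ i ci<di = *-cancelˡ-< 2 X Y (subst₂ _<_ (double X) (double Y)
        (subst₂ _<_ ∑-cross ∑-diag (sum-mono-< (λ i → M^-mono-≤ a (similarlyOrdered r↑ s↑ i) i) i ci<di)))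
        where
        double : ∀ x → x + x ≡ 2 * x
        double = solve-∀

    -- Straightening the branches of a tree

    module Domination (M-mono : ∀ {f} → Monotone f → Monotone (M f)) where

      walks-mono : ∀ a → Monotone (walks a)
      walks-mono zero    _ = ≤-refl
      walks-mono (suc a)   = M-mono (walks-mono a)

      colorings-mono : ∀ t → Monotone (colorings t)
      colorings-mono single      _ = ≤-refl
      colorings-mono (graft t s)   = Monotone-* (colorings-mono t) (M-mono (colorings-mono s))

      -- The test function `r` stands for the rest of a larger tree, attached at the root of `t`.
      -- Carrying it along lets the induction straighten one branch while everything else stays in
      -- place.
      walks-≤-colorings : ∀ t r → Monotone r → ⟨ r , walks (edges t) ⟩ ≤ ⟨ r , colorings t ⟩

      -- Self-adjointness of `M` moves the viewpoint across the edge to the root of `s`, where all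
      -- that lies outside `s` is the monotone test function `M rt`.
      join-≤ : ∀ t s r → Monotone r →
               ⟨ (λ i → r i * walks (suc (edges s)) i) , colorings t ⟩ ≤ ⟨ r , colorings (graft t s) ⟩
      join-≤ t s r r↑ = begin
        ⟨ (λ i → r i * walks (suc (edges s)) i) , colorings t ⟩  ≡⟨ swap (walks (suc (edges s))) ⟩
        ⟨ rt , M (walks (edges s)) ⟩                             ≡⟨ M-selfAdjoint rt _ ⟩
        ⟨ M rt , walks (edges s) ⟩                               ≤⟨ walks-≤-colorings s (M rt) (M-mono (Monotone-* r↑ (colorings-mono t))) ⟩
        ⟨ M rt , colorings s ⟩                                   ≡⟨ M-selfAdjoint rt _ ⟨
        ⟨ rt , M (colorings s) ⟩                                 ≡⟨ swap (M (colorings s)) ⟨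
        ⟨ (λ i → r i * M (colorings s) i) , colorings t ⟩        ≡⟨ ⟨⟩-rotate r (colorings t) _ ⟨
        ⟨ r , colorings (graft t s) ⟩                            ∎
        where
        open ≤-Reasoning
        rt : Fin k → ℕ
        rt i = r i * colorings t i
        swap : ∀ g → ⟨ (λ i → r i * g i) , colorings t ⟩ ≡ ⟨ rt , g ⟩
        swap g = trans (sym (⟨⟩-rotate r (colorings t) g)) (trans (⟨⟩-congʳ r λ i → *-comm (colorings t i) (g i)) (⟨⟩-rotate r g (colorings t)))

      -- Chebyshev's inequality for `r` and `walks b`: two paths hanging at one vertex allow at
      -- least as many colorings as the same paths joined end to end.
      fold-≤ : ∀ a b r → Monotone r → ⟨ r , walks (b + a) ⟩ ≤ ⟨ (λ i → r i * walks a i) , walks b ⟩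
      fold-≤ a b r r↑ = begin
        ⟨ r , walks (b + a) ⟩                     ≡⟨ ⟨⟩-congʳ r (M^-compose a b _) ⟨
        ⟨ r , M^ a (walks b) ⟩                    ≤⟨ chebyshev a r (walks b) r↑ (walks-mono b) ⟩
        ⟨ r , (λ i → walks a i * walks b i) ⟩     ≡⟨ sum-cong-≗ (λ i → *-assoc (r i) (walks a i) (walks b i)) ⟨
        ⟨ (λ i → r i * walks a i) , walks b ⟩     ∎
        where open ≤-Reasoning

      walks-≤-colorings single      r r↑ = ≤-refl
      -- The long path is split into two paths at the root; then `t` replaces the first, with the
      -- second absorbed into the test function, and finally `s` replaces the second.
      walks-≤-colorings (graft t s) r r↑ = begin
        ⟨ r , walks (edges t + suc (edges s)) ⟩
          ≤⟨ fold-≤ (suc (edges s)) (edges t) r r↑ ⟩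
        ⟨ (λ i → r i * walks (suc (edges s)) i) , walks (edges t) ⟩
          ≤⟨ walks-≤-colorings t _ (Monotone-* r↑ (walks-mono (suc (edges s)))) ⟩
        ⟨ (λ i → r i * walks (suc (edges s)) i) , colorings t ⟩
          ≤⟨ join-≤ t s r r↑ ⟩
        ⟨ r , colorings (graft t s) ⟩ ∎
        where open ≤-Reasoning

      ∑-walks-≤-colorings : ∀ t → sum (walks (edges t)) ≤ sum (colorings t)
      ∑-walks-≤-colorings t = subst₂ _≤_ (⟨⟩-identityˡ (walks (edges t))) (⟨⟩-identityˡ (colorings t))
        (walks-≤-colorings t (const 1) (λ _ → ≤-refl))

      -- Strictness is demanded only against rank 0: `walks 1`, the degree, already takes a single
      -- value on all inner vertices of a path.
      Strict : (Fin k → ℕ) → Set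
      Strict f = ∀ {i j} → ρ i < ρ j → ρ i ≡ 0 → f i < f j

      Positive : (Fin k → ℕ) → Set
      Positive f = ∀ i → 0 < f i

      module Strictness
        (M-strict : ∀ {f} → Monotone f → Positive f → Strict (M f))
        (v₀ : Fin k) (ρv₀≡0 : ρ v₀ ≡ 0)
        (interiorNeighbour : ∀ i → ∃ λ j → Adj i j × 0 < ρ j) where

        M-positive : ∀ {f} → Positive f → Positive (M f)
        M-positive f>0 i with j , ij , _ ← interiorNeighbour i = ≤-<-trans z≤n (M-mono-< {f = const 0} (λ _ → z≤n) ij (f>0 j))

        walks-positive : ∀ a → Positive (walks a)
        walks-positive zero    i = z<s
        walks-positive (suc a)   = M-positive (walks-positive a)

        colorings-positive : ∀ t → Positive (colorings t)
        colorings-positive single      i = z<s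
        colorings-positive (graft t s) i = *-mono-< (colorings-positive t i) (M-positive (colorings-positive s) i)

        -- Every vertex has a neighbour of positive rank, so one application of `M` makes the
        -- inequality strict everywhere, and further ones keep it so.
        M^-mono-< : ∀ a {f g} → (∀ j → f j ≤ g j) → (∀ j → 0 < ρ j → f j < g j) → ∀ i → M^ (suc a) f i < M^ (suc a) g i
        M^-mono-< zero    f≤g f<g i with j , ij , ρj>0 ← interiorNeighbour i = M-mono-< f≤g ij (f<g j ρj>0)
        M^-mono-< (suc a) f≤g f<g i with j , ij , _    ← interiorNeighbour i =
          M-mono-< (M^-mono-≤ (suc a) f≤g) ij (M^-mono-< a f≤g f<g j)

        -- Both paths have positive length: `suc b` makes `walks (suc b)` an image of `M` and hence
        -- strict, and `suc a` lets `M^-mono-<` apply.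
        fold-< : ∀ a b r → Monotone r → Strict r →
                 ⟨ r , walks (suc b + suc a) ⟩ < ⟨ (λ i → r i * walks (suc a) i) , walks (suc b) ⟩
        fold-< a b r r↑ r-strict = begin-strict
          ⟨ r , walks (suc b + suc a) ⟩                          ≡⟨ ⟨⟩-congʳ r (M^-compose (suc a) (suc b) _) ⟨
          ⟨ r , M^ (suc a) s ⟩                                   <⟨ chebyshev-< (suc a) r s r↑ s↑ v₀ at-v₀ ⟩
          ⟨ r , (λ i → walks (suc a) i * s i) ⟩                  ≡⟨ sum-cong-≗ (λ i → *-assoc (r i) (walks (suc a) i) (s i)) ⟨
          ⟨ (λ i → r i * walks (suc a) i) , s ⟩                  ∎
          where
          open ≤-Reasoning
          s = walks (suc b)
          s↑ : Monotone s
          s↑ = walks-mono (suc b)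
          -- In the row of `v₀`, which has rank 0, the rearrangement inequality is strict at each
          -- `j` of positive rank.
          at-v₀ = M^-mono-< a (similarlyOrdered r↑ s↑ v₀)
            (λ j ρj>0 → let lt = subst (_< ρ j) (sym ρv₀≡0) ρj>0 in
              rearrangement-< (r-strict lt ρv₀≡0) (M-strict (walks-mono b) (walks-positive b) lt ρv₀≡0)) v₀

        -- Two branches at the root make both lengths in the first fold positive, so that fold is
        -- strict; the later steps need only be weak.
        walks-<-colorings : ∀ t r → 2 ≤ arity t → Monotone r → Strict r →
                            ⟨ r , walks (edges t) ⟩ < ⟨ r , colorings t ⟩
        walks-<-colorings (graft t@(graft t′ s′) s) r _ r↑ r-strict = begin-strict
          ⟨ r , walks (edges t + suc (edges s)) ⟩
            ≡⟨ cong (λ b → ⟨ r , walks (b + suc (edges s)) ⟩) (+-suc (edges t′) (edges s′)) ⟩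
          ⟨ r , walks (suc (edges t′ + edges s′) + suc (edges s)) ⟩
            <⟨ fold-< (edges s) (edges t′ + edges s′) r r↑ r-strict ⟩
          ⟨ (λ i → r i * walks (suc (edges s)) i) , walks (suc (edges t′ + edges s′)) ⟩
            ≡⟨ cong (λ b → ⟨ (λ i → r i * walks (suc (edges s)) i) , walks b ⟩) (+-suc (edges t′) (edges s′)) ⟨
          ⟨ (λ i → r i * walks (suc (edges s)) i) , walks (edges t) ⟩
            ≤⟨ walks-≤-colorings t _ (Monotone-* r↑ (walks-mono (suc (edges s)))) ⟩
          ⟨ (λ i → r i * walks (suc (edges s)) i) , colorings t ⟩
            ≤⟨ join-≤ t s r r↑ ⟩
          ⟨ r , colorings (graft t s) ⟩ ∎
          where open ≤-Reasoning
        walks-<-colorings (graft single s) r (s≤s ()) r↑ r-strict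

        -- One branch at the root serves as the strict test function for the other two.
        ∑-walks-<-colorings : ∀ t → 3 ≤ arity t → sum (walks (edges t)) < sum (colorings t)
        ∑-walks-<-colorings (graft t s) (s≤s 2≤t) = begin-strict
          sum (walks (edges t + suc (edges s)))
            ≡⟨ ⟨⟩-identityˡ (walks (edges t + suc (edges s))) ⟨
          ⟨ const 1 , walks (edges t + suc (edges s)) ⟩
            ≡⟨ ⟨⟩-congʳ (const 1) (λ i → cong (λ n → walks n i) (+-comm (edges t) (suc (edges s)))) ⟩
          ⟨ const 1 , walks (suc (edges s) + edges t) ⟩
            ≡⟨ ⟨⟩-congʳ (const 1) (M^-compose (edges t) (suc (edges s)) _) ⟨
          ⟨ const 1 , M^ (edges t) (M (walks (edges s))) ⟩
            -- This cuts the path at the vertex that is to become the root, leaving `edges t` edges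
            -- on one side and `suc (edges s)` on the other.
            ≡⟨ M^-selfAdjoint (edges t) (const 1) _ ⟩
          ⟨ walks (edges t) , M (walks (edges s)) ⟩
            ≡⟨ M-selfAdjoint (walks (edges t)) _ ⟩
          ⟨ M (walks (edges t)) , walks (edges s) ⟩
            ≤⟨ walks-≤-colorings s _ (M-mono (walks-mono (edges t))) ⟩
          ⟨ M (walks (edges t)) , colorings s ⟩
            ≡⟨ M-selfAdjoint (walks (edges t)) _ ⟨
          ⟨ walks (edges t) , M (colorings s) ⟩
            ≡⟨ ⟨⟩-comm (walks (edges t)) _ ⟩
          ⟨ M (colorings s) , walks (edges t) ⟩
            <⟨ walks-<-colorings t _ 2≤t (M-mono (colorings-mono s)) (M-strict (colorings-mono s) (colorings-positive s)) ⟩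
          ⟨ M (colorings s) , colorings t ⟩
            ≡⟨ ⟨⟩-comm (M (colorings s)) _ ⟩
          sum (colorings (graft t s)) ∎
          where open ≤-Reasoning

-- The target path on an even number of vertices

𝟙-⊎ : ∀ {a b} {A : Set a} {B : Set b} (a? : Dec A) (b? : Dec B) → ¬ (A × B) → 𝟙 (a? ⊎-dec b?) ≡ 𝟙 a? + 𝟙 b?
𝟙-⊎ (yes a) (yes b) ¬ab = contradiction (a , b) ¬ab
𝟙-⊎ (yes _) (no _)  _   = refl
𝟙-⊎ (no _)  (yes _) _   = refl
𝟙-⊎ (no _)  (no _)  _   = refl

-- Extension by zero, so that a missing neighbour at an end of the path contributes nothing.
-- Accordingly `extend (0 ∷ᶠ f) x` is the value of `f` at `x` - 1, and 0 at `x` = 0.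
extend : (Fin n → ℕ) → ℕ → ℕ
extend {zero}  f x       = 0
extend {suc n} f zero    = f zero
extend {suc n} f (suc x) = extend (f ∘ suc) x

extend-toℕ : (f : Fin n → ℕ) (i : Fin n) → extend f (toℕ i) ≡ f i
extend-toℕ f zero    = refl
extend-toℕ f (suc i) = extend-toℕ (f ∘ suc) i

extend-≥ : ∀ (f : Fin n → ℕ) {x} → n ≤ x → extend f x ≡ 0
extend-≥ {zero}  f z≤n       = refl
extend-≥ {suc n} f (s≤s n≤x) = extend-≥ (f ∘ suc) n≤x

extend-< : ∀ (f : Fin n → ℕ) {x} (x<n : x < n) → extend f x ≡ f (fromℕ< x<n)
extend-< f x<n = trans (cong (extend f) (sym (toℕ-fromℕ< x<n))) (extend-toℕ f (fromℕ< x<n))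

∑-delta : (f : Fin n → ℕ) (x : ℕ) → ∑[ j < n ] (𝟙 (x ≟ℕ toℕ j) * f j) ≡ extend f x
∑-delta {zero}  f x       = refl
∑-delta {suc n} f zero    = trans (cong₂ _+_ (*-identityˡ (f zero)) (sum-replicate-zero n)) (+-identityʳ (f zero))
∑-delta {suc n} f (suc x) = ∑-delta (f ∘ suc) x

∑-delta′ : (f : Fin n → ℕ) (x : ℕ) → ∑[ j < n ] (𝟙 (suc (toℕ j) ≟ℕ x) * f j) ≡ extend (0 ∷ᶠ f) x
∑-delta′ {n} f zero = sum-replicate-zero n
∑-delta′ f (suc x) = trans
  (sum-cong-≗ λ j → cong (_* f j) (𝟙-cong (suc (toℕ j) ≟ℕ suc x) (x ≟ℕ toℕ j) (mk⇔ (sym ∘ suc-injective) (cong suc ∘ sym))))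
  (∑-delta f x)

pathGraph : ∀ n → Graph n
pathGraph n = SimpleGraph.graph (path n)

M-path : (f : Fin n → ℕ) (i : Fin n) →
         Walks.M (pathGraph n) f i ≡ extend (0 ∷ᶠ f) (toℕ i) + extend f (suc (toℕ i))
M-path {n} f i = begin
  ∑[ j < n ] (𝟙 (up j ⊎-dec down j) * f j)
    ≡⟨ sum-cong-≗ (λ j → trans (cong (_* f j) (𝟙-⊎ (up j) (down j) exclusive)) (*-distribʳ-+ (f j) (𝟙 (up j)) _)) ⟩
  ∑[ j < n ] (𝟙 (up j) * f j + 𝟙 (down j) * f j)
    ≡⟨ ∑-distrib-+ (λ j → 𝟙 (up j) * f j) (λ j → 𝟙 (down j) * f j) ⟩
  ∑[ j < n ] (𝟙 (up j) * f j) + ∑[ j < n ] (𝟙 (down j) * f j)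
    ≡⟨ cong₂ _+_ (∑-delta f (suc (toℕ i))) (∑-delta′ f (toℕ i)) ⟩
  extend f (suc (toℕ i)) + extend (0 ∷ᶠ f) (toℕ i)
    ≡⟨ +-comm (extend f (suc (toℕ i))) _ ⟩
  extend (0 ∷ᶠ f) (toℕ i) + extend f (suc (toℕ i)) ∎
  where
  open ≡-Reasoning
  up   = λ j → suc (toℕ i) ≟ℕ toℕ j
  down = λ j → suc (toℕ j) ≟ℕ toℕ i
  exclusive : ∀ {j} → ¬ (suc (toℕ i) ≡ toℕ j × suc (toℕ j) ≡ toℕ i)
  exclusive (p , q) = <-asym (≤-reflexive p) (≤-reflexive q)

module EvenPath (h : ℕ) where

  -- `top` is the last position, and `h` and `suc h` are the two middle ones, exchanged by the
  -- reflection `x` ↦ `top` - `x`.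
  top N : ℕ
  top = h + suc h
  N   = suc top

  H : Graph N
  H = pathGraph N

  endDistance : ℕ → ℕ
  endDistance x = x ⊓ (top ∸ x)

  ρ : Fin N → ℕ
  ρ i = endDistance (toℕ i)

  open Walks H using (M)
  open Chebyshev H ρ using (Monotone)

  endDistance-≤h : ∀ {x} → x ≤ h → endDistance x ≡ x
  endDistance-≤h {x} x≤h = m≤n⇒m⊓n≡m (m+n≤o⇒m≤o∸n x (+-mono-≤ x≤h (m≤n⇒m≤1+n x≤h)))

  endDistance-reflect : ∀ {x y} → x + y ≡ top → endDistance x ≡ endDistance y
  endDistance-reflect {x} {y} x+y≡top = begin
    x ⊓ (top ∸ x)  ≡⟨ cong (x ⊓_) (trans (cong (_∸ x) (sym x+y≡top)) (m+n∸m≡n x y)) ⟩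
    x ⊓ y          ≡⟨ ⊓-comm x y ⟩
    y ⊓ x          ≡⟨ cong (y ⊓_) (trans (cong (_∸ y) (sym x+y≡top)) (m+n∸n≡m x y)) ⟨
    y ⊓ (top ∸ y)  ∎
    where open ≡-Reasoning

  endDistance≤h : ∀ x → endDistance x ≤ h
  endDistance≤h x with x ≤? h
  ... | yes x≤h = ≤-trans (m⊓n≤m x _) x≤h
  ... | no  x≰h = ≤-trans (m⊓n≤n x _) (≤-trans (∸-monoʳ-≤ top (≰⇒> x≰h)) (≤-reflexive (m+n∸n≡m h (suc h))))

  -- Here the parity enters: for `d` equal to `h`, the step to `suc h` crosses to the other middle
  -- vertex, still at distance `h`. With a single middle vertex the distance would drop.
  endDistance-suc-mono : ∀ {c d} → c ≤ d → d ≤ h → endDistance (suc c) ≤ endDistance (suc d)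
  endDistance-suc-mono {c} {d} c≤d d≤h with m≤n⇒m<n∨m≡n c≤d
  ... | inj₂ refl = ≤-refl
  ... | inj₁ c<d  = ≤-trans (m⊓n≤m (suc c) _) (⊓-glb (s≤s c≤d)
    (m+n≤o⇒m≤o∸n (suc c) (+-mono-≤ (≤-trans c<d d≤h) (s≤s d≤h))))

  h<N : h < N
  h<N = s≤s (m≤m+n h (suc h))

  suc[h]<N : suc h < N
  suc[h]<N = s≤s (m≤n+m (suc h) h)

  module _ (f : Fin N → ℕ) where

    neighbourSum : ℕ → ℕ
    neighbourSum x = extend (0 ∷ᶠ f) x + extend f (suc x)

    module _ (f↑ : Monotone f) where

      extend-mono : ∀ {x y} → x < N → y < N → endDistance x ≤ endDistance y → extend f x ≤ extend f y
      extend-mono x<N y<N x≤y = subst₂ _≤_ (sym (extend-< f x<N)) (sym (extend-< f y<N))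
        (f↑ (subst₂ (λ x y → endDistance x ≤ endDistance y) (sym (toℕ-fromℕ< x<N)) (sym (toℕ-fromℕ< y<N)) x≤y))

      extend-reflect : ∀ {x y} → x + y ≡ top → extend f x ≡ extend f y
      extend-reflect {x} {y} eq = ≤-antisym (extend-mono x<N y<N (≤-reflexive (endDistance-reflect eq)))
                                        (extend-mono y<N x<N (≤-reflexive (sym (endDistance-reflect eq))))
        where
        x<N = s≤s (≤-trans (m≤m+n x y) (≤-reflexive eq))
        y<N = s≤s (≤-trans (m≤n+m y x) (≤-reflexive eq))

      -- The reflection exchanges left and right neighbours. At the two ends the missing neighbours
      -- correspond, both contributing 0.
      neighbourSum-reflect : ∀ {c x} → c ≤ h → c + x ≡ top → neighbourSum x ≡ neighbourSum c
      neighbourSum-reflect {c} {zero} c≤h eq =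
        contradiction (≤-trans (≤-reflexive (sym (trans (sym (+-identityʳ c)) eq))) c≤h) (m+1+n≰m h)
      neighbourSum-reflect {zero} {suc x} _ eq =
        trans (cong (extend f x +_) (extend-≥ f (≤-reflexive (cong suc (sym eq))))) (trans (+-identityʳ _) (extend-reflect {x} {1} (trans (+-comm x 1) eq)))
      neighbourSum-reflect {suc c} {suc x} _ eq =
        trans (cong₂ _+_ (extend-reflect {x} {2+ c} (trans (+-comm x (2+ c)) (trans (sym (+-suc (suc c) x)) eq)))
                         (extend-reflect {2+ x} {c} (trans (+-comm (2+ x) c) (trans (+-suc c (suc x)) eq))))
              (+-comm (extend f (suc (suc c))) _)

      M-endDistance : ∀ i → M f i ≡ neighbourSum (ρ i)
      M-endDistance i with toℕ i ≤? h
      ... | yes x≤h = trans (M-path f i) (cong neighbourSum (sym (endDistance-≤h x≤h)))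
      ... | no  x≰h = trans (M-path f i) (trans (neighbourSum-reflect c≤h eq) (cong neighbourSum (sym ρi≡c)))
        where
        x = toℕ i
        c = top ∸ x
        c≤h : c ≤ h
        c≤h = ≤-trans (∸-monoʳ-≤ top (≰⇒> x≰h)) (≤-reflexive (m+n∸n≡m h (suc h)))
        eq : c + x ≡ top
        eq = m∸n+n≡m (s≤s⁻¹ (toℕ<n i))
        ρi≡c : ρ i ≡ c
        ρi≡c = trans (endDistance-reflect (trans (+-comm x c) eq)) (endDistance-≤h c≤h)

      -- The neighbours on the left are compared with each other, and so are those on the right.
      neighbourSum-mono : ∀ {c d} → c ≤ d → d ≤ h → neighbourSum c ≤ neighbourSum d
      neighbourSum-mono {c} {d} c≤d d≤h = +-mono-≤ (outer c≤d d≤h)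
        (extend-mono (≤-<-trans (s≤s (≤-trans c≤d d≤h)) suc[h]<N) (≤-<-trans (s≤s d≤h) suc[h]<N) (endDistance-suc-mono c≤d d≤h))
        where
        outer : ∀ {c d} → c ≤ d → d ≤ h → extend (0 ∷ᶠ f) c ≤ extend (0 ∷ᶠ f) d
        outer z≤n       _   = z≤n
        outer {suc c} {suc d} (s≤s c≤d) d<h = extend-mono (<-trans (s≤s c≤d) (≤-<-trans d<h h<N)) (<-trans d<h h<N)
          (subst₂ _≤_ (sym (endDistance-≤h (≤-trans c≤d (<⇒≤ d<h)))) (sym (endDistance-≤h (<⇒≤ d<h))) c≤d)

      -- The left neighbour is missing at position 0 and contributes a positive value at `suc d`.
      neighbourSum-strict : (∀ i → 0 < f i) → ∀ {d} → d < h → neighbourSum 0 < neighbourSum (suc d)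
      neighbourSum-strict f>0 {d} d<h = +-mono-<-≤ (subst (0 <_) (sym (extend-< f d<N)) (f>0 (fromℕ< d<N)))
        (extend-mono (≤-<-trans (s≤s z≤n) suc[h]<N) (≤-<-trans (s≤s d<h) suc[h]<N) (endDistance-suc-mono z≤n d<h))
        where
        d<N = <-trans d<h h<N

  M-mono : ∀ {f} → Monotone f → Monotone (M f)
  M-mono {f} f↑ {i} {j} i≤j = subst₂ _≤_ (sym (M-endDistance f f↑ i)) (sym (M-endDistance f f↑ j))
    (neighbourSum-mono f f↑ i≤j (endDistance≤h (toℕ j)))

  open Chebyshev.Domination H ρ M-mono

  M-strict : ∀ {f} → Monotone f → Positive f → Strict (M f)
  M-strict {f} f↑ f>0 {i} {j} i<j ρi≡0 = subst₂ _<_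
    (trans (cong (neighbourSum f) (sym ρi≡0)) (sym (M-endDistance f f↑ i)))
    (trans (cong (neighbourSum f) (suc-pred (ρ j))) (sym (M-endDistance f f↑ j)))
    (neighbourSum-strict f f↑ f>0 (subst (_≤ h) (sym (suc-pred (ρ j))) (endDistance≤h (toℕ j))))
    where instance _ = >-nonZero (≤-<-trans z≤n i<j)

module LongEvenPath (h : ℕ) where
  open EvenPath (suc h)

  -- The neighbour is a step to the right in the left half and a step to the left in the right half.
  -- It is no end of the path, as there are at least four vertices.
  interiorNeighbour : ∀ i → ∃ λ j → Graph.Adj H i j × 0 < ρ j
  interiorNeighbour i with toℕ i ≤? suc h
  ... | yes x≤h = fromℕ< j<N , inj₁ (sym (toℕ-fromℕ< j<N)) ,
        subst (λ x → 0 < endDistance x) (sym (toℕ-fromℕ< j<N)) (≤-trans (≤-reflexive (sym (endDistance-≤h {1} (s≤s z≤n)))) (endDistance-suc-mono z≤n x≤h))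
    where
    j<N : suc (toℕ i) < N
    j<N = ≤-<-trans (s≤s x≤h) suc[h]<N
  ... | no  x≰h with toℕ i | toℕ<n i
  ...   | zero  | _   = contradiction z≤n x≰h
  ...   | suc y | y<N = fromℕ< (<⇒≤ y<N) , inj₂ (cong suc (toℕ-fromℕ< (<⇒≤ y<N))) ,
        subst (λ x → 0 < endDistance x) (sym (toℕ-fromℕ< (<⇒≤ y<N)))
          (⊓-glb (≤-<-trans z≤n (s≤s⁻¹ (≰⇒> x≰h))) (m<n⇒0<n∸m (s≤s⁻¹ y<N)))

  open Chebyshev.Domination.Strictness H ρ M-mono M-strict zero refl interiorNeighbour public
    using (∑-walks-<-colorings)

-- Colorings of paths and the conclusion

pathTree : ∀ n → RecursiveTree (suc n)
pathTree zero    = root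
pathTree (suc n) = attach (pathTree n) zero

pathTree≅path : ∀ n → Σ[ φ ∈ treeGraph (pathTree n) ≅ path (suc n) ] _≅_.to φ zero ≡ zero
pathTree≅path zero    = root≅path , refl
pathTree≅path (suc n) with φ , φ0≡0 ← pathTree≅path n = prolong φ φ0≡0 , refl

hom-path : ∀ n (H : Graph k) → hom (path (suc n)) H ≡ sum (walks H n)
hom-path n H = trans (sym (hom-≅ H (proj₁ (pathTree≅path n))))
  (trans (hom-treeGraph (pathTree n)) (sum-cong-≗ (colorings-pathTree n _ (λ _ → refl))))
  where
  open Walks H
  -- While the path is collapsed, only its newest vertex carries a nontrivial decoration, and each
  -- fold applies `M` to it once.
  colorings-pathTree : ∀ n T → (∀ i → T (suc i) ≡ single) →
                       colorings (collapse (pathTree n) T) ≗ M^ H n (colorings (T zero))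
  colorings-pathTree zero    T _ i = refl
  colorings-pathTree (suc n) T eq i = trans (colorings-pathTree n T′ (λ j → eq (suc j)) i)
    (trans (M^-cong H n new i) (M^-suc H n (colorings (T zero)) i))
    where
    T′ = updateAt (tail T) zero (λ t → graft t (T zero))
    new : colorings (T′ zero) ≗ M (colorings (T zero))
    new j rewrite eq zero = *-identityˡ _

module _ (H : Graph k) where

  sum-walks≡hom-path : (c : RecursiveTree (suc n)) → sum (walks H (edges (rootedTree c))) ≡ hom (path (suc n)) H
  sum-walks≡hom-path {n} c = trans (cong (λ e → sum (walks H e)) (edges-rootedTree c)) (sym (hom-path n H))

  sum-colorings≡hom : (c : RecursiveTree n) {T : SimpleGraph n} → treeGraph c ≅ T →
                      sum (Walks.colorings H (rootedTree c)) ≡ hom T H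
  sum-colorings≡hom c φ = trans (sym (Walks.hom-treeGraph H c)) (hom-≅ H φ)

module _ (h : ℕ) where
  open EvenPath h
  open Chebyshev.Domination H ρ M-mono using (∑-walks-≤-colorings)

  hoffmanLondon-evenPath : HoffmanLondon H
  hoffmanLondon-evenPath (suc n) _ =
    (treeGraph (pathTree n) , treeGraph-isTree (pathTree n) , hom-≅ H (proj₁ (pathTree≅path n))) , minimal
    where
    minimal : ∀ T → IsTree T → hom (path (suc n)) H ≤ hom T H
    -- Any root will do here. The bijection of vertex sets identifies the size of `c` with `suc n`.
    minimal T tree with _ , c , φ , _ ← spanning tree zero with refl ← ↔⇒≡ (_≅_.bijection φ) =
      subst₂ _≤_ (sum-walks≡hom-path H c) (sum-colorings≡hom H c φ) (∑-walks-≤-colorings (rootedTree c))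

module _ (h : ℕ) where
  open EvenPath (suc h) using (H)
  open LongEvenPath h using (∑-walks-<-colorings)

  stronglyHoffmanLondon-evenPath : StronglyHoffmanLondon H
  stronglyHoffmanLondon-evenPath (suc n) _ T tree T≇path
    with _ , c , φ , _ ← spanning tree zero with refl ← ↔⇒≡ (_≅_.bijection φ)
    with pathOrBranching c
  ... | inj₁ c≅path = contradiction (≅-trans (≅-sym φ) c≅path) T≇path
  -- The tree is spanned anew from the branching vertex, so that the root of `d` has at least three
  -- branches.
  ... | inj₂ B with _ , d , ψ , centred ← spanning tree (_≅_.to φ (Branching.centre B)) with refl ← ↔⇒≡ (_≅_.bijection ψ) =
    subst₂ _<_ (sum-walks≡hom-path H d) (sum-colorings≡hom H d ψ) (∑-walks-<-colorings (rootedTree d) 3≤arity)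
    where
    χ : T ≅ treeGraph d
    χ = ≅-sym ψ
    φχ : treeGraph c ≅ treeGraph d
    φχ = ≅-trans φ χ
    B′ : Branching (treeGraph d)
    B′ = Branching-map (_≅_.to φχ) (↔-injective (_≅_.bijection φχ)) (Equivalence.to (_≅_.adj-⇔ φχ _ _)) B
    centre≡root : Branching.centre B′ ≡ rootVertex d
    centre≡root = trans (cong (_≅_.to χ) (sym centred)) (inverseˡ (_≅_.bijection ψ))
    3≤arity : 3 ≤ arity (rootedTree d)
    3≤arity = ≤-trans (m≤m+n 3 0) (arity-collapse d (const single) (Branching.neighbour B′) (Branching.distinct B′)
      (λ i → subst (λ v → TreeAdj d v (Branching.neighbour B′ i)) centre≡root (Branching.centre-adj B′ i)))

private
  half+half≡2* : ∀ h → suc h + suc h ≡ 2 * suc h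
  half+half≡2* h = cong (suc h +_) (sym (+-identityʳ (suc h)))

theorem4p6 : (∀ (m : ℕ) → m ≥ 1 → HoffmanLondon (SimpleGraph.graph (path (2 * m)))) ×
    (∀ (m : ℕ) → m ≥ 2 → StronglyHoffmanLondon (SimpleGraph.graph (path (2 * m))))
theorem4p6 =
  (λ { (suc h) _ → subst (λ n → HoffmanLondon (pathGraph n)) (half+half≡2* h) (hoffmanLondon-evenPath h) }) ,
  (λ { (suc zero) (s≤s ())
     ; (suc (suc h)) _ → subst (λ n → StronglyHoffmanLondon (pathGraph n)) (half+half≡2* (suc h)) (stronglyHoffmanLondon-evenPath h) })
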